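{- Suppose that for all integers $n\ge3$, $d\ge0$ and $j$ with $2\le j\le n-1$ one has \[ b_{n,d}(1,j)+b_{n,d}(j,1)=2\,p_{n,d}(1,j). \] Then for every $n\ge1$ and every $d$ with $0\le d\le\lfloor (n-1)/2\rfloor$, the number of ballot permutations of $[n]$ with exactly $d$ descents equals the number of odd order permutations of $[n]$ with cyclic weight $d$, i.e. $b_{n,d}=p_{n,d}$.
   Context: For a permutation $\pi=\pi_1\cdots\pi_n$ of $[n]$ (one-line notation), an ascent is a position $t$ with $\pi_t<\pi_{t+1}$ and a descent one with $\pi_t>\pi_{t+1}$; the height of a word is its number of ascents minus its number of descents. $\pi$ is a ballot permutation if every prefix $\pi_1\cdots\pi_t$ has nonnegative height. $\mathscr{B}_{n,d}$ is the set of ballot permutations of $[n]$ with exactly $d$ descents, $b_{n,d}=\lvert\mathscr{B}_{n,d}\rvert$, and $b_{n,d}(i,j)$ is the number of $\pi\in\mathscr{B}_{n,d}$ containing $i\,n\,j$ as a factor ($\pi_t=i,\pi_{t+1}=n,\pi_{t+2}=j$ for some $t$). A cycle $(c_1\cdots c_k)$ means $c_1\mapsto c_2\mapsto\cdots\mapsto c_k\mapsto c_1$; $\operatorname{cdes}(c)=\lvert\{t\in[k]:c_t>c_{t+1}\}\rvert$, $\operatorname{casc}(c)=\lvert\{t\in[k]:c_t<c_{t+1}\}\rvert$ with $c_{k+1}=c_1$; the cyclic weight of a cycle is $\min(\operatorname{cdes}(c),\operatorname{casc}(c))$ and that of a permutation is the sum over its cycles. An odd order permutation has all cycles of odd length.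 $\mathscr{P}_{n,d}$ is the set of odd order permutations of $[n]$ with cyclic weight $d$, $p_{n,d}=\lvert\mathscr{P}_{n,d}\rvert$, and $p_{n,d}(i,j)$ is the number of $\pi\in\mathscr{P}_{n,d}$ with $\pi(i)=n$ and $\pi(n)=j$ (i.e. containing $i\,n\,j$ as a cyclic factor). -}

module Defs where

open import Data.Bool using (if_then_else_)
open import Data.Fin as Fin using (Fin; toℕ)
open import Data.Fin.Properties as Fin using (any?)
open import Data.Integer as ℤ using (ℤ; +_; 0ℤ)
open import Data.List using (List; []; _∷_; _∷ʳ_; allFin; cartesianProductWith;
  filter; inits; iterate; length; map; takeWhile)
open import Data.List.Relation.Binary.Infix.Heterogeneous using (Infix)
open import Data.List.Relation.Binary.Infix.Heterogeneous.Properties using (infix?)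
open import Data.List.Relation.Unary.All using (All; all?)
open import Data.Nat using (ℕ; zero; suc; _+_; _⊓_; _≟_)
open import Data.Nat.Divisibility using (_∣_; _∣?_)
open import Data.Nat.ListAction using (sum)
open import Data.Product using (∃; _×_)
open import Data.Vec as Vec using (Vec; lookup; toList)
open import Data.Vec.Relation.Unary.AllPairs using (allPairs?)
open import Data.Vec.Relation.Unary.Unique.Propositional using (Unique)
open import Relation.Binary.PropositionalEquality using (_≡_)
open import Relation.Nullary using (¬_; does)
open import Relation.Nullary.Decidable using (_×-dec_; ¬?)
open import Relation.Unary using (Pred; Decidable)
open import Level using (0ℓ)

-- A permutation of [n] = {1,…,n} is its one-line notation, a repetition-free
-- vector over Fin n.  The element x of Fin n stands for the letter  letter x;
-- as  letter  is strictly increasing, ascents and descents are read off Fin n.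

letter : ∀ {n} → Fin n → ℕ
letter x = suc (toℕ x)

words : ∀ n k → List (Vec (Fin n) k)
words n zero    = Vec.[] ∷ []
words n (suc k) = cartesianProductWith Vec._∷_ (allFin n) (words n k)

unique? : ∀ {n k} → Decidable (Unique {A = Fin n} {k})
unique? = allPairs? (λ x y → ¬? (x Fin.≟ y))

permutations : ∀ n → List (Vec (Fin n) n)
permutations n = filter unique? (words n n)

countPerms : ∀ n {P : Pred (Vec (Fin n) n) 0ℓ} → Decidable P → ℕ
countPerms n P? = length (filter P? (permutations n))

asc des : ∀ {n} → List (Fin n) → ℕ
asc []          = 0
asc (x ∷ [])    = 0
asc (x ∷ y ∷ w) = (if does (x Fin.<? y) then 1 else 0) + asc (y ∷ w)
des []          = 0
des (x ∷ [])    = 0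
des (x ∷ y ∷ w) = (if does (y Fin.<? x) then 1 else 0) + des (y ∷ w)

height : ∀ {n} → List (Fin n) → ℤ
height w = + asc w ℤ.- + des w

Ballot : ∀ {n} → List (Fin n) → Set
Ballot w = All (λ u → 0ℤ ℤ.≤ height u) (inits w)

ballot? : ∀ {n} → Decidable (Ballot {n})
ballot? w = all? (λ u → 0ℤ ℤ.≤? height u) (inits w)

𝓑 : ∀ n (d : ℕ) → Pred (Vec (Fin n) n) 0ℓ
𝓑 n d π = Ballot (toList π) × des (toList π) ≡ d

𝓑? : ∀ n d → Decidable (𝓑 n d)
𝓑? n d π = ballot? (toList π) ×-dec (des (toList π) ≟ d)

Factor : ∀ {n} → List ℕ → Pred (Vec (Fin n) n) 0ℓ
Factor u π = Infix (λ a x → a ≡ letter x) u (toList π)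

factor? : ∀ {n} u → Decidable (Factor {n} u)
factor? u π = infix? (λ a x → a ≟ letter x) u (toList π)

b : ℕ → ℕ → ℕ
b n d = countPerms n (𝓑? n d)

bᶠ : (n d i j : ℕ) → ℕ
bᶠ n d i j = countPerms n (λ π → 𝓑? n d π ×-dec factor? (i ∷ n ∷ j ∷ []) π)

-- The list x, π(x), π²(x), … up to the first return to x.  The return happens
-- within n steps, so n iterates suffice.
cycle : ∀ {n} → Vec (Fin n) n → Fin n → List (Fin n)
cycle {n} π x =
  x ∷ takeWhile (λ y → ¬? (y Fin.≟ x)) (iterate (lookup π) (lookup π x) n)

-- Each cycle is listed exactly once, starting from its least element.
cycles : ∀ {n} → Vec (Fin n) n → List (List (Fin n))
cycles {n} π =
  map (cycle π) (filter (λ x → all? (x Fin.≤?_) (cycle π x)) (allFin n))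

casc cdes : ∀ {n} → List (Fin n) → ℕ
casc []      = 0
casc (x ∷ c) = asc (x ∷ c ∷ʳ x)
cdes []      = 0
cdes (x ∷ c) = des (x ∷ c ∷ʳ x)

cyclicWeight : ∀ {n} → Vec (Fin n) n → ℕ
cyclicWeight π = sum (map (λ c → cdes c ⊓ casc c) (cycles π))

OddOrder : ∀ {n} → Pred (Vec (Fin n) n) 0ℓ
OddOrder π = All (λ c → ¬ (2 ∣ length c)) (cycles π)

oddOrder? : ∀ {n} → Decidable (OddOrder {n})
oddOrder? π = all? (λ c → ¬? (2 ∣? length c)) (cycles π)

𝓟 : ∀ n (d : ℕ) → Pred (Vec (Fin n) n) 0ℓ
𝓟 n d π = OddOrder π × cyclicWeight π ≡ d

𝓟? : ∀ n d → Decidable (𝓟 n d)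
𝓟? n d π = oddOrder? π ×-dec (cyclicWeight π ≟ d)

-- π(i) = j for letters i and j; false if i or j is not in [n].
Maps : ∀ {n} → (i j : ℕ) → Pred (Vec (Fin n) n) 0ℓ
Maps i j π = ∃ λ x → i ≡ letter x × j ≡ letter (lookup π x)

maps? : ∀ {n} i j → Decidable (Maps {n} i j)
maps? i j π = any? (λ x → (i ≟ letter x) ×-dec (j ≟ letter (lookup π x)))

p : ℕ → ℕ → ℕ
p n d = countPerms n (𝓟? n d)

pᶜ : (n d i j : ℕ) → ℕ
pᶜ n d i j = countPerms n (λ π → 𝓟? n d π ×-dec (maps? i n π ×-dec maps? n j π))

{-# OPTIONS --safe #-}

-- Both b and p satisfy  x(n) = x(n-1) + Σ x(i,j),  summed over the left and
-- right neighbours i, j of the greatest letter n, so it suffices to prove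
--   b(i,j) + b(j,i) = p(i,j) + p(j,i);
-- the hypothesis is the case i = 1, since p(i,j) = p(j,i).  The other cases
-- follow from  b(i,j) = b(i+1,j+1)  and  p(i,j) = p(i+1,j+1).
--
-- For p, conjugate by the rotation of the first n-1 letters.  As n-1 is not
-- next to n, turning n-1 into 1 only exchanges the ascent and the descent at
-- that letter.  Conjugating by the reversal of the first n-1 letters gives
-- p(i,j) = p(n-i,n-j), hence the symmetry of p.
--
-- For b, go from the factor i n j to (i+1) n (j+1) by swapping i with i+1 and
-- j with j+1.  A swap preserves ascents and descents unless the two swapped
-- letters are adjacent; the exceptional words are matched by an order-preserving
-- relabelling of the remaining letters.  If i < j, for instance,
--   i n j (j+1)  ↔  i (i+1) n (j+1)   and   i n (j+1) j  ↔  (i+1) i n (j+1).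
module Submission where

open import Defs
open import Data.Bool using (Bool; if_then_else_; true; false)
open import Data.Empty using (⊥; ⊥-elim)
open import Data.Fin as Fin using (Fin; zero; suc; toℕ; fromℕ; inject₁; opposite; punchIn; punchOut)
open import Data.Fin.Permutation.Components using (transpose; transpose-inverse)
import Data.Fin.Properties as Fin
open import Data.Fin.Relation.Unary.Top using (view; view-fromℕ; view-inject₁; ‵fromℕ; ‵inject₁)
open import Data.Integer as ℤ using ()
import Data.Integer.Properties as ℤ
open import Data.List as List
  using (List; []; _∷_; _∷ʳ_; _++_; map; filter; length; inits; iterate; takeWhile; allFin;
      initLast; _∷ʳ′_)
open import Data.List.Membership.Propositional using (_∈_; _∉_)
open import Data.List.Membership.Propositional.Properties
  using (∈-++⁺ˡ; ∈-++⁺ʳ; ∈-++⁻; ∈-∃++; ∈-allFin; ∈-cartesianProductWith⁺; ∈-filter⁺; ∈-filter⁻;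
      ∈-map⁺; ∈-map⁻)
import Data.List.Properties as List
open import Data.List.Relation.Binary.Infix.Heterogeneous as Infix using
    (Infix; here; there; MkView; _++ⁱ_)
open import Data.List.Relation.Binary.Infix.Heterogeneous.Properties using (infix?)
open import Data.List.Relation.Binary.Permutation.Propositional using
    (_↭_; ↭-sym; ↭-trans; ↭-refl; ↭⇒↭ₛ)
open import Data.List.Relation.Binary.Permutation.Propositional.Properties as ↭
  using (++-comm; ∈-resp-↭; ↭-length)
open import Data.List.Relation.Binary.Permutation.Setoid.Properties using (Unique-resp-↭)
open import Data.List.Relation.Binary.Pointwise as Pointwise using ([]; _∷_)
open import Data.List.Relation.Binary.Prefix.Heterogeneous using ([]; _∷_)
open import Data.List.Relation.Unary.All as All using (All; []; _∷_; all?)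
import Data.List.Relation.Unary.All.Properties as All
open import Data.List.Relation.Unary.AllPairs using ([]; _∷_)
open import Data.List.Relation.Unary.Any using (here; there)
open import Data.List.Relation.Unary.Linked using (Linked; []; [-]; _∷_)
open import Data.List.Relation.Unary.Unique.Propositional using () renaming (Unique to Uniqueᴸ)
import Data.List.Relation.Unary.Unique.Propositional.Properties as Uniqueᴸ
open import Data.Nat hiding (_≟_; _/_)
open import Data.Nat.Divisibility using (_∣_; divides; ∣⇒≤)
open import Data.Nat.GeneralisedArithmetic using (fold)
open import Data.Nat.ListAction renaming (sum to sumᴸ)
open import Data.Nat.ListAction.Properties using (sum-++; sum-↭)
open import Data.Nat.Properties hiding (_≟_)
open import Data.Product using (∃; _×_; _,_; proj₁; proj₂)
open import Data.Sum using (_⊎_; inj₁; inj₂)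
open import Data.Unit using (⊤; tt)
open import Data.Vec as Vec using (Vec; []; _∷_; lookup; tabulate; toList)
open import Data.Vec.Membership.Propositional using () renaming (_∈_ to _∈ᵛ_)
import Data.Vec.Membership.Propositional.Properties as VecMembership
import Data.Vec.Properties as Vec
import Data.Vec.Relation.Unary.All.Properties as VecAll
open import Data.Vec.Relation.Unary.AllPairs using ([]; _∷_)
open import Data.Vec.Relation.Unary.Unique.Propositional using (Unique)
import Data.Vec.Relation.Unary.Unique.Propositional.Properties as Unique
open import Function using (_∘_; const; flip; id; _⇔_; mk⇔; Equivalence)
open import Level using (0ℓ)
open import Relation.Binary using (tri<; tri≈; tri>)
open import Relation.Binary.PropositionalEquality
open import Relation.Nullary
open import Relation.Nullary.Decidable using (_×-dec_; _⊎-dec_; ¬?; dec-true; dec-false)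
open import Relation.Unary using (Pred; Decidable)
open import Algebra.Properties.CommutativeMonoid.Sum +-0-commutativeMonoid
  using (∑-distrib-+; ∑-comm) renaming (sum to ∑; sum-cong-≗ to ∑-cong)

-- The exceptional words of one swap do not match each other: those of the swap of j and j+1 are
-- matched with those of the swap of i and i+1. So b(i,j) = b(i+1,j+1) is reached only through a
-- third count. For i < j this is b(i,j+1): if A and B count the two kinds of matched exceptional
-- words, S the remaining words of the swap at j and T those of the swap at i, then b(i,j) = A + S,
-- b(i,j+1) = B + S = B + T, b(i+1,j+1) = A + T, and S = T by cancellation. The greater neighbour is
-- raised first because j may be i+1, and then raising i first would ask for the factor j n j; for i
-- > j the third count is b(i+1,j). For p the obstacle is that conjugation does not preserve the
-- least letter, by which a cycle is represented. Cycles are therefore compared through the relation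
-- of lying in one cycle, and their ascents and descents are sums over the letters, independent of
-- the starting point.

-- Counting by injective relations

-- A greedy matching: each `x` uses up one occurrence of its partner in `ys`. With weights it serves
-- both for counting (constant weight 1) and for the cyclic weight, a sum over cycles. Elements of
-- weight 0 may stay unmatched, which is needed for fixed points.
sum-matching : {A B : Set} (R : A → B → Set) (w : A → ℕ) (w′ : B → ℕ) (xs : List A) (ys : List B) →
  Uniqueᴸ xs →
  (∀ {x} → x ∈ xs → w x ≡ 0 ⊎ ∃ λ y → y ∈ ys × R x y × w x ≤ w′ y) →
  (∀ {x x′ y} → x ∈ xs → x′ ∈ xs → R x y → R x′ y → x ≡ x′) →
  sumᴸ (map w xs) ≤ sumᴸ (map w′ ys)
sum-matching R w w′ [] ys _ _ _ = z≤n
sum-matching R w w′ (x ∷ xs) ys (x∉ ∷ xs!) match inj with match (here refl)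
... | inj₁ wx≡0 rewrite wx≡0 =
  sum-matching R w w′ xs ys xs! (match ∘ there) (λ p q → inj (there p) (there q))
... | inj₂ (y , y∈ys , Rxy , wx≤) with as , bs , refl ← ∈-∃++ y∈ys = begin
  w x + sumᴸ (map w xs)
    ≤⟨ +-mono-≤ wx≤ (sum-matching R w w′ xs (as ++ bs) xs! match′ (λ p q →
        inj (there p) (there q))) ⟩
  w′ y + sumᴸ (map w′ (as ++ bs))
    ≡⟨ cong (w′ y +_) (sum-map-++ as bs) ⟩
  w′ y + (sA + sB)
    ≡⟨ +-assoc (w′ y) sA sB ⟨
  (w′ y + sA) + sB
    ≡⟨ cong (_+ sB) (+-comm (w′ y) sA) ⟩
  (sA + w′ y) + sB
    ≡⟨ +-assoc sA (w′ y) sB ⟩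
  sA + (w′ y + sB)
    ≡⟨ sum-map-++ as (y ∷ bs) ⟨
  sumᴸ (map w′ (as ++ y ∷ bs)) ∎
  where
  open ≤-Reasoning
  sA = sumᴸ (map w′ as)
  sB = sumᴸ (map w′ bs)
  sum-map-++ : ∀ us vs → sumᴸ (map w′ (us ++ vs))
             ≡ sumᴸ (map w′ us) + sumᴸ (map w′ vs)
  sum-map-++ us vs = trans (cong sumᴸ (List.map-++ w′ us vs))
                           (sum-++ (map w′ us) (map w′ vs))
  match′ : ∀ {z} → z ∈ xs → w z ≡ 0 ⊎ ∃ λ y → y ∈ as ++ bs × R z y × w z ≤ w′ y
  match′ z∈ with match (there z∈)
  ... | inj₁ e = inj₁ e
  ... | inj₂ (v , v∈ , Rzv , le) with ∈-++⁻ as v∈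
  ...   | inj₁ v∈as         = inj₂ (v , ∈-++⁺ˡ v∈as , Rzv , le)
  ...   | inj₂ (there v∈bs) = inj₂ (v , ∈-++⁺ʳ as v∈bs , Rzv , le)
  -- `z` would share the used-up partner of `x`, hence equal `x`, which does not recur in `xs`.
  ...   | inj₂ (here refl)  =
    contradiction (inj (here refl) (there z∈) Rxy Rzv) (All.lookup x∉ z∈)

length-as-sum : {A : Set} (xs : List A) → length xs ≡ sumᴸ (map (const 1) xs)
length-as-sum []       = refl
length-as-sum (x ∷ xs) = cong suc (length-as-sum xs)

∈-words : ∀ {n k} (v : Vec (Fin n) k) → v ∈ words n k
∈-words []      = here refl
∈-words (x ∷ v) = ∈-cartesianProductWith⁺ _∷_ (∈-allFin x) (∈-words v)

words-unique : ∀ n k → Uniqueᴸ (words n k)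
words-unique n zero    = [] ∷ []
words-unique n (suc k) =
  Uniqueᴸ.cartesianProductWith⁺ _∷_ Vec.∷-injective (Uniqueᴸ.allFin⁺ n) (words-unique n k)

-- The two sizes may differ, so that the greatest letter can be removed.
countPerms-≤ : ∀ {m n} {P : Pred (Vec (Fin m) m) 0ℓ} {Q : Pred (Vec (Fin n) n) 0ℓ}
  (P? : Decidable P) (Q? : Decidable Q) (R : Vec (Fin m) m → Vec (Fin n) n → Set) →
  (∀ {v} → Unique v → P v → ∃ λ w → Unique w × Q w × R v w) →
  (∀ {v v′ w} → R v w → R v′ w → v ≡ v′) →
  countPerms m P? ≤ countPerms n Q?
countPerms-≤ {m} {n} P? Q? R match inj = subst₂ _≤_
  (sym (length-as-sum (filter P? (permutations m))))
      (sym (length-as-sum (filter Q? (permutations n))))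
  (sum-matching R (const 1) (const 1) _ _
    (Uniqueᴸ.filter⁺ P? (Uniqueᴸ.filter⁺ unique? (words-unique m m)))
    (λ v∈ → let v∈p , Pv = ∈-filter⁻ P? v∈
                _ , v!   = ∈-filter⁻ unique? {xs = words m m} v∈p
                w , w! , Qw , Rvw = match v! Pv
            in inj₂ (w , ∈-filter⁺ Q? (∈-filter⁺ unique? (∈-words w) w!) Qw , Rvw , ≤-refl))
    (λ _ _ → inj))

countPerms-cong : ∀ {n} {P Q : Pred (Vec (Fin n) n) 0ℓ} (P? : Decidable P) (Q? : Decidable Q) →
  (∀ {v} → Unique v → P v → Q v) → (∀ {v} → Unique v → Q v → P v) →
  countPerms n P? ≡ countPerms n Q?
countPerms-cong P? Q? P⇒Q Q⇒P = ≤-antisym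
  (countPerms-≤ P? Q? _≡_ (λ v! Pv → _ , v! , P⇒Q v! Pv , refl) λ { refl refl → refl })
  (countPerms-≤ Q? P? _≡_ (λ v! Qv → _ , v! , Q⇒P v! Qv , refl) λ { refl refl → refl })

countPerms-empty : ∀ {n} {P : Pred (Vec (Fin n) n) 0ℓ} (P? : Decidable P) →
  (∀ {v} → Unique v → ¬ P v) → countPerms n P? ≡ 0
countPerms-empty {n} P? ¬P = cong length (List.filter-none P? (All.tabulate λ v∈ →
  ¬P (proj₂ (∈-filter⁻ unique? {xs = words n n} v∈))))

countPerms-split : ∀ {n} {P Q : Pred (Vec (Fin n) n) 0ℓ} (P? : Decidable P) (Q? : Decidable Q) →
  countPerms n P? ≡ countPerms n (λ v → P? v ×-dec Q? v) + countPerms n (λ v → P? v ×-dec ¬? (Q? v))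
countPerms-split {n} P? Q? = go (permutations n)
  where
  go : ∀ xs → length (filter P? xs)
     ≡ length (filter (λ v → P? v ×-dec Q? v) xs) + length (filter (λ v → P? v ×-dec ¬? (Q? v)) xs)
  go []       = refl
  go (x ∷ xs) with P? x | Q? x
  ... | no _  | _     = go xs
  ... | yes _ | yes _ = cong suc (go xs)
  ... | yes _ | no _  = trans (cong suc (go xs)) (sym (+-suc _ _))

countPerms-∑ : ∀ {n k} {P : Pred (Vec (Fin n) n) 0ℓ} {Q : Fin k → Pred (Vec (Fin n) n) 0ℓ}
  (P? : Decidable P) (Q? : ∀ i → Decidable (Q i)) →
  (∀ {v} → Unique v → P v → ∃ λ i → Q i v) →
  (∀ {i v} → Unique v → Q i v → P v) →
  (∀ {i j v} → Unique v → Q i v → Q j v → i ≡ j) →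
  countPerms n P? ≡ ∑ {k} (λ i → countPerms n (Q? i))
countPerms-∑ {k = zero} P? Q? cover sound disj =
  countPerms-empty P? λ v! Pv → Fin.¬Fin0 (proj₁ (cover v! Pv))
countPerms-∑ {n} {suc k} {P} {Q} P? Q? cover sound disj = begin
  countPerms n P?
    ≡⟨ countPerms-split P? (Q? zero) ⟩
  countPerms n (λ v → P? v ×-dec Q? zero v) + countPerms n P∖Q₀?
    ≡⟨ cong₂ _+_
         (countPerms-cong _ (Q? zero) (λ _ → proj₂) (λ v! q → sound v! q , q))
         (countPerms-∑ P∖Q₀? (Q? ∘ suc)
           (λ { v! (Pv , ¬q) → cover′ ¬q (cover v! Pv) })
           (λ v! q → sound v! q , λ q₀ → Fin.0≢1+n (disj v! q₀ q))
           (λ v! q q′ → Fin.suc-injective (disj v! q q′))) ⟩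
  countPerms n (Q? zero) + ∑ {k} (λ i → countPerms n (Q? (suc i))) ∎
  where
  open ≡-Reasoning
  P∖Q₀? = λ v → P? v ×-dec ¬? (Q? zero v)
  cover′ : ∀ {v} → ¬ Q zero v → (∃ λ i → Q i v) → ∃ λ i → Q (suc i) v
  cover′ ¬q (zero  , q) = contradiction q ¬q
  cover′ ¬q (suc i , q) = i , q

-- Cycles of a permutation

-- The vertices from `y` on, excluding the arrival at `z`. A path may pass through `z` earlier;
-- first returns are singled out by `no-return` below.
data Path {A : Set} (f : A → A) (z : A) : A → List A → Set where
  []  : Path f z z []
  _∷_ : ∀ y {t} → Path f z (f y) t → Path f z y (y ∷ t)

module _ {A : Set} {f : A → A} where

  path-deterministic : ∀ {z y t t′} → Path f z y t → Path f z y t′ → z ∉ t → z ∉ t′ → t ≡ t′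
  path-deterministic []      []       _   _    = refl
  path-deterministic []      (_ ∷ _)  _   z∉t′ = contradiction (here refl) z∉t′
  path-deterministic (_ ∷ _) []       z∉t _    = contradiction (here refl) z∉t
  path-deterministic (y ∷ p) (.y ∷ q) z∉t z∉t′ =
    cong (y ∷_) (path-deterministic p q (z∉t ∘ there) (z∉t′ ∘ there))

  path-++⁺ : ∀ {x y z s t} → Path f y x s → Path f z y t → Path f z x (s ++ t)
  path-++⁺ []      q = q
  path-++⁺ (x ∷ p) q = x ∷ path-++⁺ p q

  path-++⁻ : ∀ {x y z} s {t} → Path f z x (s ++ y ∷ t) → Path f y x s × Path f z (f y) t
  path-++⁻ []      (_ ∷ p) = [] , p
  path-++⁻ (x ∷ s) (_ ∷ p) with q , r ← path-++⁻ s p = x ∷ q , r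

  -- A repeated vertex would give two paths of different lengths from it to z.
  path-unique : ∀ {z y t} → Path f z y t → z ∉ t → Uniqueᴸ t
  path-unique []      _   = []
  path-unique (y ∷ p) z∉t = All.tabulate fresh ∷ path-unique p (z∉t ∘ there)
    where
    fresh : ∀ {x} → x ∈ _ → y ≢ x
    fresh x∈t refl with s , r , refl ← ∈-∃++ x∈t = m+1+n≢n (length s) (trans
      (sym (List.length-++ s)) (cong length (path-deterministic p (proj₂ (path-++⁻ s p))
        (z∉t ∘ there) (z∉t ∘ there ∘ ∈-++⁺ʳ s ∘ there))))

-- A specification of `cycle` by the first return. By `loop-deterministic` it determines the list,
-- so later arguments never unfold `takeWhile` and `iterate`.
record Loop {A : Set} (f : A → A) (x : A) (c : List A) : Set where
  constructor loop
  field
    {tail}    : List A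
    shape     : c ≡ x ∷ tail
    path      : Path f x (f x) tail
    no-return : x ∉ tail

module _ {A : Set} {f : A → A} where

  loop-deterministic : ∀ {x c c′} → Loop f x c → Loop f x c′ → c ≡ c′
  loop-deterministic (loop refl p x∉) (loop refl p′ x∉′) =
      cong (_ ∷_) (path-deterministic p p′ x∉ x∉′)

  -- The arcs before and after `y` change places; `y` does not recur because a loop has no repeated
  -- vertex (`path-unique`).
  loop-rotate : ∀ {x y c} → Loop f x c → y ∈ c → ∃ λ c′ → Loop f y c′ × c ↭ c′
  loop-rotate         l@(loop refl _ _) (here refl) = _ , l , ↭-refl
  loop-rotate {x} {y} (loop refl p x∉) (there y∈) with u , v , refl ← ∈-∃++ y∈ = _ ,
    loop refl (path-++⁺ (proj₂ (path-++⁻ u p)) (x ∷ proj₁ (path-++⁻ u p))) y∉ ,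
    ++-comm (x ∷ u) (y ∷ v)
    where
    y∉ : y ∉ v ++ x ∷ u
    y∉ with y∉ ∷ _ ← Unique-resp-↭ (setoid A) (↭⇒↭ₛ (++-comm (x ∷ u) (y ∷ v)))
                       (All.¬Any⇒All¬ _ x∉ ∷ path-unique p x∉) = All.All¬⇒¬Any y∉

  loop-map : ∀ {B : Set} {g : B → B} {φ : A → B} → (∀ {x y} → φ x ≡ φ y → x ≡ y) →
    (∀ x → g (φ x) ≡ φ (f x)) → ∀ {x c} → Loop f x c → Loop g (φ x) (map φ c)
  loop-map {g = g} {φ} φ-inj comm {x} (loop refl p x∉) = loop refl
    (subst (λ z → Path g _ z _) (sym (comm x)) (path-map p))
    λ φx∈ → let y , y∈ , eq = ∈-map⁻ φ φx∈ in x∉ (subst (_∈ _) (sym (φ-inj eq)) y∈)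
    where
    path-map : ∀ {z y t} → Path f z y t → Path g (φ z) (φ y) (map φ t)
    path-map []      = []
    path-map (y ∷ p) = φ y ∷ subst (λ z → Path g _ z _) (sym (comm y)) (path-map p)

  -- `g` and `u` differ by the coboundary of `h`, which telescopes to zero around a loop. The
  -- additive form of the hypothesis avoids subtraction.
  loop-cohomologous : ∀ {x c} (g u h : A → ℕ) → (∀ y → g y + h (f y) ≡ u y + h y) →
    Loop f x c → sumᴸ (map g c) ≡ sumᴸ (map u c)
  loop-cohomologous {x} g u h eq (loop refl p _) = +-cancelʳ-≡ (h x) _ _ (go (x ∷ p))
    where
    open ≡-Reasoning
    go : ∀ {z y t} → Path f z y t → sumᴸ (map g t) + h z ≡ sumᴸ (map u t) + h y
    go []                  = refl
    go {z} {t = _ ∷ t} (y ∷ p) = begin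
      g y + sumᴸ (map g t) + h z     ≡⟨ +-assoc (g y) _ _ ⟩
      g y + (sumᴸ (map g t) + h z)   ≡⟨ cong (g y +_) (go p) ⟩
      g y + (sumᴸ (map u t) + h (f y)) ≡⟨ cong (g y +_) (+-comm _ (h (f y))) ⟩
      g y + (h (f y) + sumᴸ (map u t)) ≡⟨ +-assoc (g y) _ _ ⟨
      g y + h (f y) + sumᴸ (map u t) ≡⟨ cong (_+ sumᴸ (map u t)) (eq y) ⟩
      u y + h y + sumᴸ (map u t)     ≡⟨ +-assoc (u y) _ _ ⟩
      u y + (h y + sumᴸ (map u t))   ≡⟨ cong (u y +_) (+-comm (h y) _) ⟩
      u y + (sumᴸ (map u t) + h y)   ≡⟨ +-assoc (u y) _ _ ⟨
      u y + sumᴸ (map u t) + h y     ∎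

-- Ascents and descents along a cycle

opaque
  rise : ∀ {n} → Fin n → Fin n → Bool
  rise x y = does (x Fin.<? y)

  rise-< : ∀ {n} {x y : Fin n} → x Fin.< y → rise x y ≡ true
  rise-< {x = x} {y} = dec-true (x Fin.<? y)

  rise-≮ : ∀ {n} {x y : Fin n} → ¬ x Fin.< y → rise x y ≡ false
  rise-≮ {x = x} {y} = dec-false (x Fin.<? y)

rise-cong : ∀ {m n} {x y : Fin m} {x′ y′ : Fin n} →
  (x Fin.< y → x′ Fin.< y′) → (x′ Fin.< y′ → x Fin.< y) → rise x′ y′ ≡ rise x y
rise-cong {x = x} {y} to from with x Fin.<? y
... | yes x<y = trans (rise-< (to x<y)) (sym (rise-< x<y))
... | no  x≮y = trans (rise-≮ (x≮y ∘ from)) (sym (rise-≮ x≮y))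

opaque
  up : ∀ {n} → Fin n → Fin n → ℕ
  up x y = if rise x y then 1 else 0

  up-< : ∀ {n} {x y : Fin n} → x Fin.< y → up x y ≡ 1
  up-< x<y = cong (if_then 1 else 0) (rise-< x<y)

  up-≮ : ∀ {n} {x y : Fin n} → ¬ x Fin.< y → up x y ≡ 0
  up-≮ x≮y = cong (if_then 1 else 0) (rise-≮ x≮y)

  up-cong : ∀ {m n} {x y : Fin m} {x′ y′ : Fin n} →
    (x Fin.< y → x′ Fin.< y′) → (x′ Fin.< y′ → x Fin.< y) → up x′ y′ ≡ up x y
  up-cong to from = cong (if_then 1 else 0) (rise-cong to from)

down : ∀ {n} → Fin n → Fin n → ℕ
down x y = up y x

module _ {n} {f : Fin n → Fin n} where

  opaque
    unfolding rise up

    path-asc : ∀ {z y t} → Path f z y t → asc (t ∷ʳ z) ≡ sumᴸ (map (λ x → up x (f x)) t)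
    path-asc []            = refl
    path-asc (y ∷ [])      = refl
    path-asc (y ∷ _ ∷ p)   = cong (up y (f y) +_) (path-asc (_ ∷ p))

    path-des : ∀ {z y t} → Path f z y t → des (t ∷ʳ z) ≡ sumᴸ (map (λ x → down x (f x)) t)
    path-des []            = refl
    path-des (y ∷ [])      = refl
    path-des (y ∷ _ ∷ p)   = cong (down y (f y) +_) (path-des (_ ∷ p))

  -- As a sum over vertices the statistic no longer depends on where the cycle starts.
  loop-casc : ∀ {x c} → Loop f x c → casc c ≡ sumᴸ (map (λ x → up x (f x)) c)
  loop-casc {x} (loop refl p _) = path-asc (x ∷ p)

  loop-cdes : ∀ {x c} → Loop f x c → cdes c ≡ sumᴸ (map (λ x → down x (f x)) c)
  loop-cdes {x} (loop refl p _) = path-des (x ∷ p)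

least : ∀ {n} (x : Fin n) xs → ∃ λ m → m ∈ x ∷ xs × All (m Fin.≤_) (x ∷ xs)
least x []       = x , here refl , ≤-refl ∷ []
least x (y ∷ xs) with m , m∈ , m≤ ← least y xs with ≤-total (toℕ x) (toℕ m)
... | inj₁ x≤m = x , here refl , ≤-refl ∷ All.map (≤-trans x≤m) m≤
... | inj₂ m≤x = m , there m∈ , m≤x ∷ m≤

minimal? : ∀ {n} (π : Vec (Fin n) n) (x : Fin n) → Dec (All (x Fin.≤_) (cycle π x))
minimal? π x = all? (x Fin.≤?_) (cycle π x)

leaders : ∀ {n} → Vec (Fin n) n → List (Fin n)
leaders {n} π = filter (minimal? π) (allFin n)

weight : ∀ {n} → List (Fin n) → ℕ
weight c = cdes c ⊓ casc c

module Cycles {n} (π : Vec (Fin n) n) (π! : Unique π) where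
  f = lookup π

  -- Injectivity cancels applications of `f` on both sides until the starting point itself recurs.
  fold-return : ∀ x i j → i < j → fold x f i ≡ fold x f j → ∃ λ e → e < j × f (fold x f e) ≡ x
  fold-return x zero    (suc j) _         eq = j , ≤-refl , sym eq
  fold-return x (suc i) (suc j) (s≤s i<j) eq
    with e , e<j , eq′ ← fold-return x i j i<j (Unique.lookup-injective π! _ _ eq) =
        e , m≤n⇒m≤1+n e<j , eq′

  fold-shift : ∀ x e → f (fold x f e) ≡ fold (f x) f e
  fold-shift x zero    = refl
  fold-shift x (suc e) = cong f (fold-shift x e)

  ∈-iterate : ∀ y e k → e < k → fold y f e ∈ iterate f y k
  ∈-iterate y zero    (suc k) _         = here refl
  ∈-iterate y (suc e) (suc k) (s≤s e<k) =
    there (subst (_∈ iterate f (f y) k) (sym (fold-shift y e)) (∈-iterate (f y) e k e<k))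

  -- Pigeonhole on the n + 1 points reached after 0 to n steps. The return time is e + 1 with e < n,
  -- so n iterates starting from `f x` contain the return.
  periodic : ∀ x → ∃ λ e → e < n × f (fold x f e) ≡ x
  periodic x with i , j , i<j , eq ← Fin.pigeonhole (n<1+n n) (λ i → fold x f (toℕ i))
             with e , e<j , eq′ ← fold-return x (toℕ i) (toℕ j) i<j eq =
    e , ≤-trans e<j (s≤s⁻¹ (Fin.toℕ<n j)) , eq′

  preimage : ∀ x → ∃ λ y → f y ≡ x
  preimage x with e , _ , eq ← periodic x = fold x f e , eq

  return : ∀ x → x ∈ iterate f (f x) n
  return x with e , e<n , eq ← periodic x =
    subst (_∈ iterate f (f x) n) (trans (sym (fold-shift x e)) eq) (∈-iterate (f x) e n e<n)

  -- As `x` occurs in the list, `takeWhile` stops because of `x` and not because the list is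
  -- exhausted.
  takeWhile-path : ∀ x y k → x ∈ iterate f y k →
    let t = takeWhile (λ z → ¬? (z Fin.≟ x)) (iterate f y k) in Path f x y t × x ∉ t
  takeWhile-path x y (suc k) x∈ with y Fin.≟ x
  takeWhile-path x y (suc k) x∈         | yes refl = [] , λ ()
  takeWhile-path x y (suc k) (here eq)  | no y≢x   = contradiction (sym eq) y≢x
  takeWhile-path x y (suc k) (there x∈) | no y≢x with p , x∉ ← takeWhile-path x (f y) k x∈ =
    y ∷ p , λ { (here eq) → y≢x (sym eq) ; (there x∈) → x∉ x∈ }

  cycle-loop : ∀ x → Loop f x (cycle π x)
  cycle-loop x with p , x∉ ← takeWhile-path x (f x) n (return x) = loop refl p x∉

  cycle-↭ : ∀ {x y} → y ∈ cycle π x → cycle π x ↭ cycle π y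
  cycle-↭ {x} {y} y∈ with c , l , ↭c ← loop-rotate (cycle-loop x) y∈ =
    subst (cycle π x ↭_) (loop-deterministic l (cycle-loop y)) ↭c

  cycle-sym : ∀ {x y} → y ∈ cycle π x → x ∈ cycle π y
  cycle-sym y∈ = ∈-resp-↭ (cycle-↭ y∈) (here refl)

  weight-cong : ∀ {x y} → y ∈ cycle π x → weight (cycle π x) ≡ weight (cycle π y)
  weight-cong {x} {y} y∈ = cong₂ _⊓_
    (trans (loop-cdes (cycle-loop x))
        (trans (sum-↭ (↭.map⁺ _ (cycle-↭ y∈))) (sym (loop-cdes (cycle-loop y)))))
    (trans (loop-casc (cycle-loop x))
        (trans (sum-↭ (↭.map⁺ _ (cycle-↭ y∈))) (sym (loop-casc (cycle-loop y)))))

  leader : ∀ x → ∃ λ r → r ∈ leaders π × x ∈ cycle π r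
  leader x with m , m∈ , m≤ ← least x (List.drop 1 (cycle π x)) =
    m , ∈-filter⁺ (minimal? π) (∈-allFin m) (All.tabulate λ z∈ →
        All.lookup m≤ (∈-resp-↭ (↭-sym (cycle-↭ m∈)) z∈)) ,
    cycle-sym m∈

  leader-unique : ∀ {r r′ x} → r ∈ leaders π → r′ ∈ leaders π → x ∈ cycle π r → x ∈ cycle π r′ →
      r ≡ r′
  leader-unique {r} {r′} r∈ r′∈ x∈r x∈r′ = Fin.toℕ-injective (≤-antisym
    (All.lookup (min r∈) (∈-resp-↭ (↭-sym r↭r′) (here refl)))
    (All.lookup (min r′∈) (∈-resp-↭ r↭r′ (here refl))))
    where
    r↭r′ = ↭-trans (cycle-↭ x∈r) (↭-sym (cycle-↭ x∈r′))
    min : ∀ {z} → z ∈ leaders π → All (z Fin.≤_) (cycle π z)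
    min z∈ = proj₂ (∈-filter⁻ (minimal? π) {xs = allFin n} z∈)

  leaders-unique : Uniqueᴸ (leaders π)
  leaders-unique = Uniqueᴸ.filter⁺ (minimal? π) (Uniqueᴸ.allFin⁺ n)

-- Odd order and cyclic weight under a map of the letters

Intertwines : ∀ {m n} → (Fin m → Fin n) → Vec (Fin m) m → Vec (Fin n) n → Set
Intertwines φ π π′ = ∀ x → lookup π′ (φ x) ≡ φ (lookup π x)

weight-[x] : ∀ {n} (x : Fin n) → weight (x ∷ []) ≡ 0
weight-[x] x rewrite dec-false (x Fin.<? x) (<-irrefl refl) = refl

-- One setting for conjugation, where `φ` is a bijection, and for adding a fixed point, where `φ` is
-- `inject₁`.
module Transport {m n} {φ : Fin m → Fin n} (φ-inj : ∀ {x y} → φ x ≡ φ y → x ≡ y)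
  {π : Vec (Fin m) m} {π′ : Vec (Fin n) n} (π! : Unique π) (π′! : Unique π′)
  (comm : Intertwines φ π π′) where

  private
    module C  = Cycles π π!
    module C′ = Cycles π′ π′!

  cycle-map : ∀ x → cycle π′ (φ x) ≡ map φ (cycle π x)
  cycle-map x = loop-deterministic (C′.cycle-loop (φ x)) (loop-map φ-inj comm (C.cycle-loop x))

  cycle-length : ∀ x → length (cycle π′ (φ x)) ≡ length (cycle π x)
  cycle-length x = trans (cong length (cycle-map x)) (List.length-map φ (cycle π x))

  cycle-∈ : ∀ {x y} → φ y ∈ cycle π′ (φ x) → y ∈ cycle π x
  cycle-∈ {x} {y} φy∈ with z , z∈ , eq ← ∈-map⁻ φ (subst (φ y ∈_) (cycle-map x) φy∈) =
    subst (_∈ cycle π x) (sym (φ-inj eq)) z∈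

  cycle-∈′ : ∀ {x y} → y ∈ cycle π x → φ y ∈ cycle π′ (φ x)
  cycle-∈′ {x} {y} y∈ = subst (φ y ∈_) (sym (cycle-map x)) (∈-map⁺ φ y∈)

  private
    ∑-cycle : (e : Fin n → Fin n → ℕ) → ∀ x →
      sumᴸ (map (λ y → e y (lookup π′ y)) (cycle π′ (φ x))) ≡
      sumᴸ (map (λ y → e (φ y) (φ (lookup π y))) (cycle π x))
    ∑-cycle e x = begin
      sumᴸ (map (λ y → e y (lookup π′ y)) (cycle π′ (φ x)))
        ≡⟨ cong (sumᴸ ∘ map _) (cycle-map x) ⟩
      sumᴸ (map (λ y → e y (lookup π′ y)) (map φ (cycle π x)))
        ≡⟨ cong sumᴸ (List.map-∘ (cycle π x)) ⟨
      sumᴸ (map (λ y → e (φ y) (lookup π′ (φ y))) (cycle π x))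
        ≡⟨ cong sumᴸ (List.map-cong (λ y → cong (e (φ y)) (comm y)) (cycle π x)) ⟩
      sumᴸ (map (λ y → e (φ y) (φ (lookup π y))) (cycle π x)) ∎
      where open ≡-Reasoning

    casc-map : ∀ x → casc (cycle π′ (φ x)) ≡
        sumᴸ (map (λ y → up (φ y) (φ (lookup π y))) (cycle π x))
    casc-map x = trans (loop-casc (C′.cycle-loop (φ x))) (∑-cycle up x)

    cdes-map : ∀ x → cdes (cycle π′ (φ x)) ≡
        sumᴸ (map (λ y → down (φ y) (φ (lookup π y))) (cycle π x))
    cdes-map x = trans (loop-cdes (C′.cycle-loop (φ x))) (∑-cycle down x)

  -- The potential h accounts for a letter moved past its neighbours: what one
  -- of its two edges gains, the other one loses.
  weight-map : (h : Fin m → ℕ) →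
    (∀ y → let z = lookup π y in
      up (φ y) (φ z) + h z ≡ up y z + h y × up (φ z) (φ y) + h y ≡ up z y + h z) →
    ∀ x → weight (cycle π x) ≡ weight (cycle π′ (φ x))
  weight-map h eq x = sym (cong₂ _⊓_
    (trans (cdes-map x) (trans (sym (loop-cohomologous _ _ h (λ y → sym (proj₂ (eq y))) l))
        (sym (loop-cdes l))))
    (trans (casc-map x) (trans (loop-cohomologous _ _ h (λ y → proj₁ (eq y)) l)
        (sym (loop-casc l)))))
    where l = C.cycle-loop x

  -- For a `φ` that reverses the order up to a potential: `cdes` and `casc` trade places, and their
  -- minimum does not change.
  weight-flip : (h : Fin m → ℕ) →
    (∀ y → let z = lookup π y in
      up (φ y) (φ z) + h y ≡ up z y + h z × up (φ z) (φ y) + h z ≡ up y z + h y) →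
    ∀ x → weight (cycle π x) ≡ weight (cycle π′ (φ x))
  weight-flip h eq x = trans (⊓-comm (cdes (cycle π x)) _) (sym (cong₂ _⊓_
    (trans (cdes-map x) (trans (loop-cohomologous _ _ h (λ y → proj₂ (eq y)) l)
        (sym (loop-casc l))))
    (trans (casc-map x) (trans (sym (loop-cohomologous _ _ h (λ y → sym (proj₁ (eq y))) l))
        (sym (loop-cdes l))))))
    where l = C.cycle-loop x

  -- Outside the image of `φ` only fixed points occur. They are cycles of length 1 and weight 0, so
  -- they affect neither `OddOrder` nor `cyclicWeight`.
  module _ (weight-eq : ∀ x → weight (cycle π x) ≡ weight (cycle π′ (φ x)))
           (cover : ∀ x′ → (∃ λ x → φ x ≡ x′) ⊎ lookup π′ x′ ≡ x′) where

    private
      cycle-fixed : ∀ {x′} → lookup π′ x′ ≡ x′ → cycle π′ x′ ≡ x′ ∷ []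
      cycle-fixed {x′} fix = loop-deterministic (C′.cycle-loop x′)
        (loop refl (subst (λ z → Path _ x′ z []) (sym fix) []) λ ())

      fixed-weight : ∀ {x′} → lookup π′ x′ ≡ x′ → weight (cycle π′ x′) ≡ 0
      fixed-weight {x′} fix = trans (cong weight (cycle-fixed fix)) (weight-[x] x′)

    -- `φ` need not send the least letter of a cycle to the least letter of its image, so leaders
    -- are paired by lying in corresponding cycles. In the second inequality the fixed points stay
    -- unmatched.
    cyclicWeight-map : cyclicWeight π ≡ cyclicWeight π′
    cyclicWeight-map = subst₂ _≡_ (cong sumᴸ (List.map-∘ (leaders π)))
        (cong sumᴸ (List.map-∘ (leaders π′)))
      (≤-antisym
        (sum-matching (λ r r′ → φ r ∈ cycle π′ r′) _ _ _ _ C.leaders-unique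
          (λ {r} r∈ → let r′ , r′∈ , φr∈ = C′.leader (φ r) in
            inj₂ (r′ , r′∈ , φr∈ , ≤-reflexive (trans (weight-eq r) (sym (C′.weight-cong φr∈)))))
          λ r₁∈ r₂∈ φr₁∈ φr₂∈ → C.leader-unique r₁∈ r₂∈
            (cycle-∈ (∈-resp-↭ (C′.cycle-↭ φr₁∈) φr₂∈)) (here refl))
        (sum-matching (λ r′ r → φ r ∈ cycle π′ r′) _ _ _ _ C′.leaders-unique
          (λ {r′} _ → match r′ (cover r′))
          λ r₁∈ r₂∈ → C′.leader-unique r₁∈ r₂∈))
      where
      match : ∀ r′ → (∃ λ x → φ x ≡ r′) ⊎ lookup π′ r′ ≡ r′ →
        weight (cycle π′ r′) ≡ 0 ⊎ ∃ λ r → r ∈ leaders π × φ r ∈ cycle π′ r′ ×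
            weight (cycle π′ r′) ≤ weight (cycle π r)
      match r′ (inj₂ fix)         = inj₁ (fixed-weight fix)
      match r′ (inj₁ (x , refl)) with r , r∈ , x∈ ← C.leader x =
        inj₂ (r , r∈ , cycle-∈′ (C.cycle-sym x∈) ,
          ≤-reflexive (trans (sym (weight-eq x)) (C.weight-cong (C.cycle-sym x∈))))

    oddOrder-map⁺ : OddOrder π → OddOrder π′
    oddOrder-map⁺ odd = All.map⁺ (All.tabulate λ {r′} _ → odd′ r′ (cover r′))
      where
      odd′ : ∀ r′ → (∃ λ x → φ x ≡ r′) ⊎ lookup π′ r′ ≡ r′ → ¬ (2 ∣ length (cycle π′ r′))
      odd′ r′ (inj₂ fix) 2∣ = <⇒≱ (n<1+n 1) (∣⇒≤ (subst (λ c → 2 ∣ length c) (cycle-fixed fix) 2∣))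
      odd′ r′ (inj₁ (x , refl)) 2∣ with r , r∈ , x∈ ← C.leader x =
        All.lookup (All.map⁻ odd) r∈ (subst (2 ∣_)
          (trans (cycle-length x) (↭-length (↭-sym (C.cycle-↭ x∈)))) 2∣)

    oddOrder-map⁻ : OddOrder π′ → OddOrder π
    oddOrder-map⁻ odd = All.map⁺ (All.tabulate λ {r} _ 2∣ →
      let r′ , r′∈ , φr∈ = C′.leader (φ r) in
      All.lookup (All.map⁻ odd) r′∈
        (subst (2 ∣_) (trans (sym (cycle-length r)) (↭-length (↭-sym (C′.cycle-↭ φr∈)))) 2∣))

    𝓟-map⁺ : ∀ {d} → 𝓟 m d π → 𝓟 n d π′
    𝓟-map⁺ (odd , refl) = oddOrder-map⁺ odd , sym cyclicWeight-map

    𝓟-map⁻ : ∀ {d} → 𝓟 n d π′ → 𝓟 m d π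
    𝓟-map⁻ (odd , refl) = oddOrder-map⁻ odd , cyclicWeight-map

-- Odd order permutations by the neighbours of the greatest letter

top : ∀ {n} → Fin (suc n)
top {n} = fromℕ n

top≢inject₁ : ∀ {n} {i : Fin n} → top ≢ inject₁ i
top≢inject₁ = Fin.fromℕ≢inject₁

inject₁<top : ∀ {n} (i : Fin n) → inject₁ i Fin.< top
inject₁<top {n} i = subst₂ _<_ (sym (Fin.toℕ-inject₁ i)) (sym (Fin.toℕ-fromℕ n)) (Fin.toℕ<n i)

top≮ : ∀ {n} (x : Fin (suc n)) → ¬ top Fin.< x
top≮ {n} x lt = <⇒≱ lt (subst (toℕ x ≤_) (sym (Fin.toℕ-fromℕ n)) (s≤s⁻¹ (Fin.toℕ<n x)))

inject₁-mono-< : ∀ {n} {i j : Fin n} → i Fin.< j → inject₁ i Fin.< inject₁ j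
inject₁-mono-< {i = i} {j} = subst₂ _<_ (sym (Fin.toℕ-inject₁ i)) (sym (Fin.toℕ-inject₁ j))

inject₁-cancel-< : ∀ {n} {i j : Fin n} → inject₁ i Fin.< inject₁ j → i Fin.< j
inject₁-cancel-< {i = i} {j} = subst₂ _<_ (Fin.toℕ-inject₁ i) (Fin.toℕ-inject₁ j)

up-inject₁ : ∀ {n} (i j : Fin n) → up (inject₁ i) (inject₁ j) ≡ up i j
up-inject₁ i j = up-cong inject₁-mono-< inject₁-cancel-<

lift : ∀ {m n} → (Fin m → Fin n) → Fin (suc m) → Fin (suc n)
lift φ i with view i
... | ‵fromℕ     = top
... | ‵inject₁ j = inject₁ (φ j)

lift-top : ∀ {m n} (φ : Fin m → Fin n) → lift φ top ≡ top
lift-top {m} φ rewrite view-fromℕ m = refl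

lift-inject₁ : ∀ {m n} (φ : Fin m → Fin n) i → lift φ (inject₁ i) ≡ inject₁ (φ i)
lift-inject₁ φ i rewrite view-inject₁ i = refl

lift-inverse : ∀ {m n} (φ : Fin m → Fin n) (ψ : Fin n → Fin m) → (∀ i → ψ (φ i) ≡ i) →
  ∀ i → lift ψ (lift φ i) ≡ i
lift-inverse φ ψ eq i with view i
... | ‵fromℕ     = lift-top ψ
... | ‵inject₁ j = trans (lift-inject₁ ψ (φ j)) (cong inject₁ (eq j))

rotate rotate⁻¹ : ∀ {n} → Fin (suc n) → Fin (suc n)
rotate i with view i
... | ‵fromℕ     = zero
... | ‵inject₁ j = suc j
rotate⁻¹ zero    = top
rotate⁻¹ (suc j) = inject₁ j

rotate-top : ∀ {n} → rotate (top {n}) ≡ zero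
rotate-top {n} rewrite view-fromℕ n = refl

rotate-inject₁ : ∀ {n} (i : Fin n) → rotate (inject₁ i) ≡ suc i
rotate-inject₁ i rewrite view-inject₁ i = refl

rotate-inverseˡ : ∀ {n} (i : Fin (suc n)) → rotate⁻¹ (rotate i) ≡ i
rotate-inverseˡ i with view i
... | ‵fromℕ     = refl
... | ‵inject₁ j = refl

rotate-inverseʳ : ∀ {n} (i : Fin (suc n)) → rotate (rotate⁻¹ i) ≡ i
rotate-inverseʳ zero    = rotate-top
rotate-inverseʳ (suc j) = rotate-inject₁ j

inverse⇒injective : ∀ {A B : Set} (σ : A → B) (τ : B → A) → (∀ x → τ (σ x) ≡ x) → ∀ {x y} →
    σ x ≡ σ y → x ≡ y
inverse⇒injective σ τ inv {x} {y} eq = trans (sym (inv x)) (trans (cong τ eq) (inv y))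

lookup-ext : ∀ {A : Set} {n} {v w : Vec A n} → (∀ i → lookup v i ≡ lookup w i) → v ≡ w
lookup-ext {v = v} {w} eq =
    trans (sym (Vec.tabulate∘lookup v)) (trans (Vec.tabulate-cong eq) (Vec.tabulate∘lookup w))

module Conjugate {n} {σ τ : Fin n → Fin n} (τσ : ∀ x → τ (σ x) ≡ x) (στ : ∀ x → σ (τ x) ≡ x) where

  conjugate : (σ τ : Fin n → Fin n) → Vec (Fin n) n → Vec (Fin n) n
  conjugate σ τ π = tabulate (λ x → σ (lookup π (τ x)))

  conjugate-unique : ∀ (σ τ : Fin n → Fin n) → (∀ {x y} → σ x ≡ σ y → x ≡ y) →
      (∀ {x y} → τ x ≡ τ y → x ≡ y) →
    ∀ {π} → Unique π → Unique (conjugate σ τ π)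
  conjugate-unique σ τ σ-inj τ-inj π! =
      Unique.tabulate⁺ (τ-inj ∘ Unique.lookup-injective π! _ _ ∘ σ-inj)

  conjugate-intertwines : ∀ (σ τ : Fin n → Fin n) → (∀ x → τ (σ x) ≡ x) → ∀ π →
      Intertwines σ π (conjugate σ τ π)
  conjugate-intertwines σ τ τσ π x =
      trans (Vec.lookup∘tabulate _ (σ x)) (cong (σ ∘ lookup π) (τσ x))

  countPerms-conjugate : ∀ {P Q : Pred (Vec (Fin n) n) 0ℓ} (P? : Decidable P) (Q? : Decidable Q) →
    (∀ {π π′} → Unique π → Unique π′ → Intertwines σ π π′ → P π → Q π′) →
    (∀ {π π′} → Unique π → Unique π′ → Intertwines σ π π′ → Q π′ → P π) →
    countPerms n P? ≡ countPerms n Q?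
  countPerms-conjugate P? Q? to from = ≤-antisym
    (countPerms-≤ P? Q? (Intertwines σ)
      (λ {π} π! Pπ → let π′! = conjugate-unique σ τ (inverse⇒injective σ τ τσ)
                           (inverse⇒injective τ σ στ) π!
                         R   = conjugate-intertwines σ τ τσ π
                     in _ , π′! , to π! π′! R Pπ , R)
      (λ R R′ → lookup-ext λ i → inverse⇒injective σ τ τσ (trans (sym (R i)) (R′ i))))
    (countPerms-≤ Q? P? (flip (Intertwines σ))
      (λ {π′} π′! Qπ′ → let π! = conjugate-unique τ σ (inverse⇒injective τ σ στ)
                              (inverse⇒injective σ τ τσ) π′!
                            R  = λ x → sym (trans (cong σ (conj-σ π′ x)) (στ _))
                        in _ , π! , from π! π′! R Qπ′ , R)
      (λ {v} {v′} R R′ → lookup-ext λ i →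
          subst (λ j → lookup v j ≡ lookup v′ j) (στ i) (trans (R (τ i)) (sym (R′ (τ i))))))
    where
    conj-σ : ∀ π′ x → lookup (conjugate τ σ π′) x ≡ τ (lookup π′ (σ x))
    conj-σ π′ x = Vec.lookup∘tabulate _ x

𝓟-through : ∀ {N} d (i j : Fin N) → Pred (Vec (Fin (suc N)) (suc N)) 0ℓ
𝓟-through {N} d i j π = 𝓟 (suc N) d π × lookup π (inject₁ i) ≡ top × lookup π top ≡ inject₁ j

𝓟-through? : ∀ {N} d (i j : Fin N) → Decidable (𝓟-through d i j)
𝓟-through? {N} d i j π = 𝓟? (suc N) d π ×-dec (lookup π (inject₁ i) Fin.≟ top) ×-dec
    (lookup π top Fin.≟ inject₁ j)

p-through : ∀ {N} → ℕ → Fin N → Fin N → ℕ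
p-through {N} d i j = countPerms (suc N) (𝓟-through? d i j)

-- `lift σ` fixes `top`, so conjugation turns the cyclic factor i n j into σ(i) n σ(j), and only the
-- weights of cycles remain to be checked. That check may use the neighbours of `top`, hence the two
-- equations among its premises.
p-through-lift : ∀ {N} d (i j : Fin N) {i′ j′} (σ τ : Fin N → Fin N) →
  (∀ x → τ (σ x) ≡ x) → (∀ x → σ (τ x) ≡ x) → σ i ≡ i′ → σ j ≡ j′ →
  (∀ {π π′} → Unique π → (π′! : Unique π′) → Intertwines (lift σ) π π′ →
     lookup π (inject₁ i) ≡ top → lookup π top ≡ inject₁ j →
     ∀ x → weight (cycle π x) ≡ weight (cycle π′ (lift σ x))) →
  p-through d i j ≡ p-through d i′ j′
p-through-lift d i j σ τ τσ στ refl refl weight-eq = countPerms-conjugate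
  (𝓟-through? d i j) (𝓟-through? d (σ i) (σ j))
  (λ {π} {π′} π! π′! R (Pπ , i↦top , top↦j) →
    Transport.𝓟-map⁺ σ-inj π! π′! R (weight-eq π! π′! R i↦top top↦j) (λ x →
        inj₁ (lift τ x , lift-inverse τ σ στ x)) Pπ ,
    trans (cong (lookup π′) (sym (lift-inject₁ σ i)))
        (trans (R (inject₁ i)) (trans (cong (lift σ) i↦top) (lift-top σ))) ,
    trans (cong (lookup π′) (sym (lift-top σ)))
        (trans (R top) (trans (cong (lift σ) top↦j) (lift-inject₁ σ j))))
  (λ {π} {π′} π! π′! R (Pπ′ , i↦top′ , top↦j′) →
    let i↦top : lookup π (inject₁ i) ≡ top
        i↦top = σ-inj (trans (sym (R (inject₁ i)))
            (trans (cong (lookup π′) (lift-inject₁ σ i)) (trans i↦top′ (sym (lift-top σ)))))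
        top↦j : lookup π top ≡ inject₁ j
        top↦j = σ-inj (trans (sym (R top))
            (trans (cong (lookup π′) (lift-top σ)) (trans top↦j′ (sym (lift-inject₁ σ j)))))
    in Transport.𝓟-map⁻ σ-inj π! π′! R (weight-eq π! π′! R i↦top top↦j) (λ x →
        inj₁ (lift τ x , lift-inverse τ σ στ x)) Pπ′ ,
       i↦top , top↦j)
  where
  open Conjugate {σ = lift σ} {lift τ} (lift-inverse σ τ τσ) (lift-inverse τ σ στ)
  σ-inj : ∀ {x y} → lift σ x ≡ lift σ y → x ≡ y
  σ-inj = inverse⇒injective (lift σ) (lift τ) (lift-inverse σ τ τσ)

opaque
  [_≟_] : ∀ {n} → Fin n → Fin n → ℕ
  [ x ≟ y ] = if does (x Fin.≟ y) then 1 else 0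

  [≡] : ∀ {n} {x y : Fin n} → x ≡ y → [ x ≟ y ] ≡ 1
  [≡] {x = x} {y} eq rewrite dec-true (x Fin.≟ y) eq = refl

  [≢] : ∀ {n} {x y : Fin n} → x ≢ y → [ x ≟ y ] ≡ 0
  [≢] {x = x} {y} neq rewrite dec-false (x Fin.≟ y) neq = refl

-- Comparisons among lower letters are reversed, but `top` stays greatest. The indicators correct
-- the edges at `top`; they form a potential because a cycle enters and leaves `top` equally often.
up-opposite : ∀ {N} (y z : Fin (suc N)) →
  up (lift opposite y) (lift opposite z) + [ y ≟ top ] ≡ up z y + [ z ≟ top ]
up-opposite y z with view y | view z
... | ‵fromℕ     | ‵fromℕ     = refl
... | ‵fromℕ     | ‵inject₁ c = trans (cong₂ _+_ (up-≮ (top≮ _)) ([≡] refl))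
                                  (sym (cong₂ _+_ (up-< (inject₁<top c)) ([≢] (top≢inject₁ ∘ sym))))
... | ‵inject₁ a | ‵fromℕ     =
    trans (cong₂ _+_ (up-< (inject₁<top (opposite a))) ([≢] (top≢inject₁ ∘ sym)))
                                  (sym (cong₂ _+_ (up-≮ (top≮ (inject₁ a))) ([≡] refl)))
... | ‵inject₁ a | ‵inject₁ c = cong₂ _+_
  (trans (up-inject₁ (opposite a) (opposite c))
      (trans (up-cong (opposite-< {i = c}) opposite-<⁻) (sym (up-inject₁ c a))))
  (trans ([≢] (top≢inject₁ ∘ sym)) (sym ([≢] (top≢inject₁ ∘ sym))))
  where
  opposite-< : ∀ {n} {i j : Fin n} → i Fin.< j → opposite j Fin.< opposite i
  opposite-< {n} {i} {j} i<j = subst₂ _<_ (sym (Fin.opposite-prop j)) (sym (Fin.opposite-prop i))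
    (∸-monoʳ-< (s≤s i<j) (Fin.toℕ<n j))
  opposite-<⁻ : ∀ {n} {i j : Fin n} → opposite j Fin.< opposite i → i Fin.< j
  opposite-<⁻ {i = i} {j} lt =
      subst₂ Fin._<_ (Fin.opposite-involutive i) (Fin.opposite-involutive j) (opposite-< lt)

p-through-opposite : ∀ {N} d (i j : Fin N) → p-through d i j ≡ p-through d (opposite i) (opposite j)
p-through-opposite {N} d i j = p-through-lift d i j opposite opposite Fin.opposite-involutive
    Fin.opposite-involutive refl refl
  λ {π} {π′} π! π′! R _ _ →
      Transport.weight-flip (inverse⇒injective (lift opposite) (lift opposite)
      (lift-inverse opposite opposite Fin.opposite-involutive)) π! π′! R
    [_≟ top ] (λ y → up-opposite y (lookup π y) , up-opposite (lookup π y) y)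

-- The two greatest letters compare differently with each other after the
-- rotation, so the identity excludes that pair.
up-rotate : ∀ {M} (y z : Fin (suc (suc M))) →
  ¬ (y ≡ inject₁ top × z ≡ top) → ¬ (y ≡ top × z ≡ inject₁ top) →
  up (lift rotate y) (lift rotate z) + [ z ≟ inject₁ top ] ≡ up y z + [ y ≟ inject₁ top ]
up-rotate {M} y z ¬mt ¬tm with view y | view z
... | ‵fromℕ     | ‵fromℕ     = refl
... | ‵fromℕ     | ‵inject₁ c =
  cong₂ _+_ (trans (up-≮ (top≮ (inject₁ (rotate c)))) (sym (up-≮ (top≮ (inject₁ c)))))
            (trans ([≢] λ eq → ¬tm (refl , eq)) (sym ([≢] (top≢inject₁ {i = top {M}}))))
... | ‵inject₁ a | ‵fromℕ     =
  cong₂ _+_ (trans (up-< (inject₁<top (rotate a))) (sym (up-< (inject₁<top a))))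
            (trans ([≢] (top≢inject₁ {i = top {M}})) (sym ([≢] λ eq → ¬mt (eq , refl))))
... | ‵inject₁ a | ‵inject₁ c with view a | view c
...   | ‵fromℕ     | ‵fromℕ     =
    cong₂ _+_ (trans (up-≮ (<-irrefl refl)) (sym (up-≮ (<-irrefl refl)))) refl
...   | ‵fromℕ     | ‵inject₁ c =
  trans (cong₂ _+_ (up-< (inject₁-mono-< {i = zero} {suc c} z<s))
      ([≢] (top≢inject₁ ∘ sym ∘ Fin.inject₁-injective)))
        (sym (cong₂ _+_ (up-≮ (top≮ _ ∘ inject₁-cancel-<)) ([≡] refl)))
...   | ‵inject₁ a | ‵fromℕ     =
  trans (cong₂ _+_ (up-≮ (n≮0 ∘ inject₁-cancel-< {i = suc a} {zero})) ([≡] refl))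
        (sym (cong₂ _+_ (up-< (inject₁-mono-< (inject₁<top a)))
            ([≢] (top≢inject₁ ∘ sym ∘ Fin.inject₁-injective))))
...   | ‵inject₁ a | ‵inject₁ c =
  cong₂ _+_ (trans (up-inject₁ (suc a) (suc c))
      (trans (up-cong {x = inject₁ a} {inject₁ c} (s≤s ∘ inject₁-cancel-<) (inject₁-mono-< ∘ s≤s⁻¹))
              (sym (up-inject₁ (inject₁ a) (inject₁ c)))))
            (trans ([≢] (top≢inject₁ ∘ sym ∘ Fin.inject₁-injective))
                (sym ([≢] (top≢inject₁ ∘ sym ∘ Fin.inject₁-injective))))

p-through-toric : ∀ {M} d (a b : Fin M) → p-through d (inject₁ a) (inject₁ b) ≡
    p-through d (suc a) (suc b)
p-through-toric d a b = p-through-lift d (inject₁ a) (inject₁ b) rotate rotate⁻¹ rotate-inverseˡ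
    rotate-inverseʳ (rotate-inject₁ a) (rotate-inject₁ b)
  λ {π} π! π′! R a↦top top↦b →
    -- The neighbours of `top` are `inject₁ (inject₁ a)` and `inject₁ (inject₁ b)`, never the second
    -- greatest letter `inject₁ top`; so the pair excluded by `up-rotate` does not occur.
    let ¬m↦top : ∀ y → ¬ (y ≡ inject₁ top × lookup π y ≡ top)
        ¬m↦top y (y≡m , y↦top) = top≢inject₁ (Fin.inject₁-injective
            (trans (sym y≡m) (Unique.lookup-injective π! _ _ (trans y↦top (sym a↦top)))))
        ¬top↦m : ∀ y → ¬ (y ≡ top × lookup π y ≡ inject₁ top)
        ¬top↦m y (y≡top , y↦m) = top≢inject₁
            (Fin.inject₁-injective (trans (sym y↦m) (trans (cong (lookup π) y≡top) top↦b)))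
    in Transport.weight-map (inverse⇒injective (lift rotate) (lift rotate⁻¹)
        (lift-inverse rotate rotate⁻¹ rotate-inverseˡ)) π! π′! R [_≟ inject₁ top ]
         λ y → up-rotate y (lookup π y) (¬m↦top y) (¬top↦m y) ,
               up-rotate (lookup π y) y (λ (p , q) → ¬top↦m y (q , p)) (λ (p , q) →
                   ¬m↦top y (q , p))

-- Removing the greatest letter from the last position

≢top⇒inject₁ : ∀ {n} {x : Fin (suc n)} → x ≢ top → ∃ λ i → x ≡ inject₁ i
≢top⇒inject₁ {x = x} x≢ with view x
... | ‵fromℕ     = contradiction refl x≢
... | ‵inject₁ i = i , refl

injective⇒unique : ∀ {A : Set} {n} (v : Vec A n) → (∀ {i j} → lookup v i ≡ lookup v j → i ≡ j) →
    Unique v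
injective⇒unique v inj = subst Unique (Vec.tabulate∘lookup v) (Unique.tabulate⁺ inj)

-- It plays two roles: for a permutation as a map it adds a fixed point, for a word it appends the
-- greatest letter.
extend : ∀ {n} → Vec (Fin n) n → Vec (Fin (suc n)) (suc n)
extend v = Vec.map inject₁ v Vec.∷ʳ top

lookup-∷ʳ-top : ∀ {A : Set} {n} (v : Vec A n) x → lookup (v Vec.∷ʳ x) top ≡ x
lookup-∷ʳ-top Vec.[]      x = refl
lookup-∷ʳ-top (_ Vec.∷ v) x = lookup-∷ʳ-top v x

lookup-∷ʳ-inject₁ : ∀ {A : Set} {n} (v : Vec A n) x i → lookup (v Vec.∷ʳ x) (inject₁ i) ≡ lookup v i
lookup-∷ʳ-inject₁ (_ Vec.∷ v) x zero    = refl
lookup-∷ʳ-inject₁ (_ Vec.∷ v) x (suc i) = lookup-∷ʳ-inject₁ v x i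

extend-top : ∀ {n} (v : Vec (Fin n) n) → lookup (extend v) top ≡ top
extend-top v = lookup-∷ʳ-top (Vec.map inject₁ v) top

extend-inject₁ : ∀ {n} (v : Vec (Fin n) n) → Intertwines inject₁ v (extend v)
extend-inject₁ v i = trans (lookup-∷ʳ-inject₁ (Vec.map inject₁ v) top i)
    (Vec.lookup-map i inject₁ v)

extend-injective : ∀ {n} {v w : Vec (Fin n) n} → extend v ≡ extend w → v ≡ w
extend-injective {v = v} {w} eq = lookup-ext λ i → Fin.inject₁-injective
  (trans (sym (extend-inject₁ v i))
      (trans (cong (λ u → lookup u (inject₁ i)) eq) (extend-inject₁ w i)))

extend-unique : ∀ {n} {v : Vec (Fin n) n} → Unique v → Unique (extend v)
extend-unique {n} {v} v! = injective⇒unique (extend v) inj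
  where
  inj : ∀ {i j} → lookup (extend v) i ≡ lookup (extend v) j → i ≡ j
  inj {i} {j} eq with view i | view j
  ... | ‵fromℕ     | ‵fromℕ     = refl
  ... | ‵fromℕ     | ‵inject₁ b =
      contradiction (trans (sym (extend-top v)) (trans eq (extend-inject₁ v b))) top≢inject₁
  ... | ‵inject₁ a | ‵fromℕ     =
      contradiction (trans (sym (extend-top v)) (trans (sym eq) (extend-inject₁ v a))) top≢inject₁
  ... | ‵inject₁ a | ‵inject₁ b = cong inject₁ (Unique.lookup-injective v! a b
    (Fin.inject₁-injective (trans (sym (extend-inject₁ v a)) (trans eq (extend-inject₁ v b)))))

extend-surjective : ∀ {n} {w : Vec (Fin (suc n)) (suc n)} → Unique w → lookup w top ≡ top →
  ∃ λ v → Unique v × w ≡ extend v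
extend-surjective {n} {w} w! fix = v , injective⇒unique v inj , lookup-ext eq
  where
  lower : ∀ i → ∃ λ j → lookup w (inject₁ i) ≡ inject₁ j
  lower i = ≢top⇒inject₁ λ eq → top≢inject₁ (Unique.lookup-injective w! _ _ (trans fix (sym eq)))
  v = tabulate (proj₁ ∘ lower)
  v-inject₁ : ∀ i → lookup w (inject₁ i) ≡ inject₁ (lookup v i)
  v-inject₁ i = trans (proj₂ (lower i)) (cong inject₁ (sym (Vec.lookup∘tabulate _ i)))
  inj : ∀ {i j} → lookup v i ≡ lookup v j → i ≡ j
  inj {i} {j} eq = Fin.inject₁-injective (Unique.lookup-injective w! _ _
    (trans (v-inject₁ i) (trans (cong inject₁ eq) (sym (v-inject₁ j)))))
  eq : ∀ i → lookup w i ≡ lookup (extend v) i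
  eq i with view i
  ... | ‵fromℕ     = trans fix (sym (extend-top v))
  ... | ‵inject₁ j = trans (v-inject₁ j) (sym (extend-inject₁ v j))

countPerms-extend : ∀ {n} {P : Pred (Vec (Fin n) n) 0ℓ} {Q : Pred (Vec (Fin (suc n)) (suc n)) 0ℓ}
  (P? : Decidable P) (Q? : Decidable Q) →
  (∀ {v} → Unique v → P v → Q (extend v)) → (∀ {v} → Unique v → Q (extend v) → P v) →
  countPerms (suc n) (λ w → Q? w ×-dec (lookup w top Fin.≟ top)) ≡ countPerms n P?
countPerms-extend {Q = Q} P? Q? to from = ≤-antisym
  (countPerms-≤ _ P? (λ w v → w ≡ extend v)
    (λ { w! (Qw , fix) → let v , v! , eq = extend-surjective w! fix in
         v , v! , from v! (subst Q eq Qw) , eq })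
    (λ eq eq′ → trans eq (sym eq′)))
  (countPerms-≤ P? _ (λ v w → w ≡ extend v)
    (λ {v} v! Pv → _ , extend-unique v! , (to v! Pv , extend-top v) , refl)
    (λ eq eq′ → extend-injective (trans (sym eq) eq′)))

-- Either n is fixed, and dropping this cycle of odd length and weight 0 changes neither condition,
-- or n has an image j and a preimage i, both smaller than n.
p-suc : ∀ N d → p (suc N) d ≡ p N d + ∑ {N} λ j → ∑ {N} λ i → p-through d i j
p-suc N d = begin
  p (suc N) d
    ≡⟨ countPerms-split (𝓟? (suc N) d) top-fixed? ⟩
  countPerms (suc N) (λ π → 𝓟? (suc N) d π ×-dec top-fixed? π) + countPerms (suc N) (λ π →
      𝓟? (suc N) d π ×-dec ¬? (top-fixed? π))
    ≡⟨ cong₂ _+_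
         (countPerms-extend (𝓟? N d) (𝓟? (suc N) d)
           (λ {v} v! → Transport.𝓟-map⁺ Fin.inject₁-injective v! (extend-unique v!)
               (extend-inject₁ v) (inject₁-weight v!) (inject₁-cover v))
           (λ {v} v! → Transport.𝓟-map⁻ Fin.inject₁-injective v! (extend-unique v!)
               (extend-inject₁ v) (inject₁-weight v!) (inject₁-cover v)))
         (trans (countPerms-∑ _ top↦?
           (λ { _ (Pπ , ¬fix) → let j , eq = ≢top⇒inject₁ ¬fix in j , Pπ , eq })
           (λ { _ (Pπ , eq) → Pπ , λ fix → top≢inject₁ (trans (sym fix) eq) })
           (λ { _ (_ , eq) (_ , eq′) → Fin.inject₁-injective (trans (sym eq) eq′) }))
         (∑-cong λ j → countPerms-∑ (top↦? j) (λ i → 𝓟-through? d i j)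
           (λ { {π} π! (Pπ , top↦j) →
             let y , y↦top = Cycles.preimage π π! top
                 i , y≡i   = ≢top⇒inject₁ λ y≡top →
                     top≢inject₁ (trans (sym y↦top) (trans (cong (lookup π) y≡top) top↦j))
             in i , Pπ , trans (cong (lookup π) (sym y≡i)) y↦top , top↦j })
           (λ { _ (Pπ , _ , eq) → Pπ , eq })
           (λ { π! (_ , eq , _) (_ , eq′ , _) →
               Fin.inject₁-injective (Unique.lookup-injective π! _ _ (trans eq (sym eq′))) }))) ⟩
  p N d + ∑ {N} (λ j → ∑ {N} λ i → p-through d i j) ∎
  where
  open ≡-Reasoning
  top-fixed? : Decidable (λ (π : Vec (Fin (suc N)) (suc N)) → lookup π top ≡ top)
  top-fixed? π = lookup π top Fin.≟ top
  top↦? : ∀ j → Decidable (λ π → 𝓟 (suc N) d π × lookup π top ≡ inject₁ j)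
  top↦? j π = 𝓟? (suc N) d π ×-dec (lookup π top Fin.≟ inject₁ j)
  inject₁-weight : ∀ {v} (v! : Unique v) → ∀ x →
      weight (cycle v x) ≡ weight (cycle (extend v) (inject₁ x))
  inject₁-weight {v} v! = Transport.weight-map Fin.inject₁-injective v! (extend-unique v!)
      (extend-inject₁ v)
    (λ _ → 0) λ y → cong (_+ 0) (up-inject₁ _ _) , cong (_+ 0) (up-inject₁ _ _)
  inject₁-cover : ∀ v (x′ : Fin (suc N)) → (∃ λ x → inject₁ x ≡ x′) ⊎ lookup (extend v) x′ ≡ x′
  inject₁-cover v x′ with view x′
  ... | ‵fromℕ     = inj₂ (extend-top v)
  ... | ‵inject₁ i = inj₁ (i , refl)

-- If i maps to n and n back to i, they form a cycle of even length 2.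
p-through-diagonal : ∀ {N} d (i : Fin N) → p-through d i i ≡ 0
p-through-diagonal {N} d i =
    countPerms-empty (𝓟-through? d i i) λ {π} π! ((odd , _) , i↦top , top↦i) →
  let open Cycles π π!
      r , r∈ , i∈ = leader (inject₁ i)
      two : cycle π (inject₁ i) ≡ inject₁ i ∷ top ∷ []
      two = loop-deterministic (cycle-loop (inject₁ i)) (loop refl
        (subst (λ y → Path (lookup π) _ y _) (sym i↦top)
            (top ∷ subst (λ y → Path (lookup π) _ y _) (sym top↦i) []))
        λ { (here eq) → top≢inject₁ (sym eq) })
  in All.lookup (All.map⁻ odd) r∈ (divides 1 (trans (↭-length (cycle-↭ i∈)) (cong length two)))

pᶜ≡p-through : ∀ {N} d (i j : Fin N) → pᶜ (suc N) d (suc (toℕ i)) (suc (toℕ j)) ≡ p-through d i j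
pᶜ≡p-through {N} d i j = countPerms-cong _ (𝓟-through? d i j)
  (λ { {π} _ (Pπ , (x , i≡x , top≡) , (y , top≡y , j≡)) →
    Pπ , trans (cong (lookup π) (sym (inject₁≡ i≡x))) (is-top top≡) ,
         trans (cong (lookup π) (sym (is-top top≡y))) (inject₁≡ j≡) })
  (λ { {π} _ (Pπ , i↦top , top↦j) →
    Pπ , (inject₁ i , cong suc (sym (Fin.toℕ-inject₁ i)) , cong suc
        (trans (sym (Fin.toℕ-fromℕ N)) (cong toℕ (sym i↦top)))) ,
         (top , cong suc (sym (Fin.toℕ-fromℕ N)) , cong suc
             (trans (sym (Fin.toℕ-inject₁ j)) (cong toℕ (sym top↦j)))) })
  where
  inject₁≡ : ∀ {i : Fin N} {x} → suc (toℕ i) ≡ letter x → x ≡ inject₁ i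
  inject₁≡ {i} eq = Fin.toℕ-injective (trans (sym (suc-injective eq)) (sym (Fin.toℕ-inject₁ i)))
  is-top : ∀ {x : Fin (suc N)} → suc N ≡ letter x → x ≡ top
  is-top eq = Fin.toℕ-injective (trans (sym (suc-injective eq)) (sym (Fin.toℕ-fromℕ N)))

-- Functions constant along diagonals

module Toric {M} (G : Fin (suc M) → Fin (suc M) → ℕ)
  (toric : ∀ a b → G (inject₁ a) (inject₁ b) ≡ G (suc a) (suc b)) where

  -- The equation is i - j = i′ - j′ without subtraction. Pairs slide down their diagonal to the
  -- border, where equal differences make them coincide. The bound `k` carries the recursion, as
  -- `inject₁ a` is not a subterm of `suc a`.
  toric-difference : ∀ i j i′ j′ → toℕ i + toℕ j′ ≡ toℕ i′ + toℕ j → G i j ≡ G i′ j′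
  toric-difference i j i′ j′ = go (toℕ i + toℕ i′) i j i′ j′ ≤-refl
    where
    go : ∀ k i j i′ j′ → toℕ i + toℕ i′ ≤ k → toℕ i + toℕ j′ ≡ toℕ i′ + toℕ j → G i j ≡ G i′ j′
    go k       zero    j       zero     j′       _        eq =
        cong (G zero) (Fin.toℕ-injective (sym eq))
    go (suc k) (suc a) (suc b) i′       j′       (s≤s le) eq = trans (sym (toric a b))
      (go k (inject₁ a) (inject₁ b) i′ j′
        (subst (λ n → n + _ ≤ k) (sym (Fin.toℕ-inject₁ a)) le)
        (subst₂ (λ m n → m + _ ≡ toℕ i′ + n) (sym (Fin.toℕ-inject₁ a)) (sym (Fin.toℕ-inject₁ b))
          (suc-injective (trans eq (+-suc (toℕ i′) (toℕ b))))))
    go k       (suc a) zero    i′       zero     _        eq =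
      cong (λ i → G i zero) (Fin.toℕ-injective (+-cancelʳ-≡ 0 _ _ eq))
    go (suc k) i       j       (suc a′) (suc b′) le       eq = trans
      (go k i j (inject₁ a′) (inject₁ b′)
        (subst (λ n → _ + n ≤ k) (sym (Fin.toℕ-inject₁ a′))
            (s≤s⁻¹ (subst (_≤ suc k) (+-suc (toℕ i) (toℕ a′)) le)))
        (subst₂ (λ m n → toℕ i + m ≡ n + toℕ j) (sym (Fin.toℕ-inject₁ b′))
            (sym (Fin.toℕ-inject₁ a′))
          (suc-injective (trans (sym (+-suc (toℕ i) (toℕ b′))) eq))))
      (toric a′ b′)

  -- A letter and its opposite have constant sum, so the pair of opposites has the same difference
  -- as the transposed pair.
  symmetric : (∀ i j → G i j ≡ G (opposite i) (opposite j)) → ∀ i j → G i j ≡ G j i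
  symmetric flip i j = trans (flip i j) (toric-difference (opposite i) (opposite j) j i
    (trans (opposite-+ i) (trans (sym (opposite-+ j)) (+-comm (toℕ (opposite j)) (toℕ j)))))
    where
    opposite-+ : ∀ (i : Fin (suc M)) → toℕ (opposite i) + toℕ i ≡ M
    opposite-+ i = trans (cong (_+ toℕ i) (Fin.opposite-prop i)) (m∸n+n≡m (s≤s⁻¹ (Fin.toℕ<n i)))

-- Words and their up-down signatures

signature : ∀ {n} → List (Fin n) → List Bool
signature []          = []
signature (x ∷ [])    = []
signature (x ∷ y ∷ w) = rise x y ∷ signature (y ∷ w)

StaysAbove : ℕ → List Bool → Set
StaysAbove h       []          = ⊤
StaysAbove h       (true  ∷ s) = StaysAbove (suc h) s
StaysAbove zero    (false ∷ s) = ⊥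
StaysAbove (suc h) (false ∷ s) = StaysAbove h s

falls : List Bool → ℕ
falls []          = 0
falls (true  ∷ s) = falls s
falls (false ∷ s) = suc (falls s)

BallotPath : ℕ → List Bool → Set
BallotPath d s = StaysAbove 0 s × falls s ≡ d

asc-< : ∀ {n} {x y : Fin n} w → x Fin.< y → asc (x ∷ y ∷ w) ≡ suc (asc (y ∷ w))
asc-< {x = x} {y} w x<y rewrite dec-true (x Fin.<? y) x<y = refl

asc-> : ∀ {n} {x y : Fin n} w → y Fin.< x → asc (x ∷ y ∷ w) ≡ asc (y ∷ w)
asc-> {x = x} {y} w y<x rewrite dec-false (x Fin.<? y) (<-asym y<x) = refl

des-< : ∀ {n} {x y : Fin n} w → x Fin.< y → des (x ∷ y ∷ w) ≡ des (y ∷ w)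
des-< {x = x} {y} w x<y rewrite dec-false (y Fin.<? x) (<-asym x<y) = refl

des-> : ∀ {n} {x y : Fin n} w → y Fin.< x → des (x ∷ y ∷ w) ≡ suc (des (y ∷ w))
des-> {x = x} {y} w y<x rewrite dec-true (y Fin.<? x) y<x = refl

des-signature : ∀ {n} {w : List (Fin n)} → Linked _≢_ w → des w ≡ falls (signature w)
des-signature []  = refl
des-signature [-] = refl
des-signature {w = x ∷ y ∷ w} (x≢y ∷ l) with Fin.<-cmp x y
... | tri≈ _ x≡y _   = contradiction x≡y x≢y
... | tri< x<y _ _   rewrite rise-< x<y = trans (des-< w x<y) (des-signature l)
... | tri> x≮y _ y<x rewrite rise-≮ x≮y = trans (des-> w y<x) (cong suc (des-signature l))

-- `h` is the height of the part read so far, which ends at `x`; keeping `x` in front of each prefix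
-- retains the next step. `Linked _≢_` makes every step an ascent or a descent.
prefixes⇔ : ∀ {n} h (x : Fin n) w → Linked _≢_ (x ∷ w) →
  All (λ u → des (x ∷ u) ≤ h + asc (x ∷ u)) (inits w) ⇔ StaysAbove h (signature (x ∷ w))
prefixes⇔ h x []      _         = mk⇔ _ λ _ → z≤n ∷ []
prefixes⇔ h x (y ∷ w) (x≢y ∷ l) with Fin.<-cmp x y
... | tri≈ _ x≡y _   = contradiction x≡y x≢y
... | tri< x<y _ _   rewrite rise-< x<y = mk⇔
  (λ { (_ ∷ ps) → Equivalence.to (prefixes⇔ (suc h) y w l)
    (All.map (λ {u} → subst₂ _≤_ (des-< u x<y) (trans (cong (h +_) (asc-< u x<y)) (+-suc h _)))
        (All.map⁻ ps)) })
  (λ s → z≤n ∷ All.map⁺ (All.map (λ {u} →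
      subst₂ _≤_ (sym (des-< u x<y)) (sym (trans (cong (h +_) (asc-< u x<y)) (+-suc h _))))
    (Equivalence.from (prefixes⇔ (suc h) y w l) s)))
prefixes⇔ zero x (y ∷ w) (x≢y ∷ l) | tri> x≮y _ y<x rewrite rise-≮ x≮y = mk⇔
  (λ { (_ ∷ (le ∷ _)) → n≮0 (subst₂ _≤_ (des-> [] y<x) (asc-> [] y<x) le) }) λ ()
prefixes⇔ (suc h) x (y ∷ w) (x≢y ∷ l) | tri> x≮y _ y<x rewrite rise-≮ x≮y = mk⇔
  (λ { (_ ∷ ps) → Equivalence.to (prefixes⇔ h y w l)
    (All.map (λ {u} → s≤s⁻¹ ∘ subst₂ _≤_ (des-> u y<x) (cong (suc h +_) (asc-> u y<x)))
        (All.map⁻ ps)) })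
  (λ s → z≤n ∷ All.map⁺ (All.map (λ {u} →
      subst₂ _≤_ (sym (des-> u y<x)) (sym (cong (suc h +_) (asc-> u y<x))) ∘ s≤s)
    (Equivalence.from (prefixes⇔ h y w l) s)))

ballot⇔ : ∀ {n} {w : List (Fin n)} → Linked _≢_ w → Ballot w ⇔ StaysAbove 0 (signature w)
ballot⇔ {w = []}    _ = mk⇔ _ λ _ → ℤ.≤-refl ∷ []
ballot⇔ {w = x ∷ w} l = mk⇔
  (λ { (_ ∷ ps) → Equivalence.to (prefixes⇔ 0 x w l)
      (All.map (ℤ.drop‿+≤+ ∘ ℤ.0≤i-j⇒j≤i) (All.map⁻ ps)) })
  (λ s → ℤ.≤-refl ∷ All.map⁺
      (All.map (ℤ.i≤j⇒0≤j-i ∘ ℤ.+≤+) (Equivalence.from (prefixes⇔ 0 x w l) s)))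

toList-unique : ∀ {A : Set} {n} {v : Vec A n} → Unique v → Uniqueᴸ (toList v)
toList-unique []        = []
toList-unique (x∉ ∷ v!) = VecAll.toList⁺ x∉ ∷ toList-unique v!

unique⇒linked : ∀ {A : Set} {w : List A} → Uniqueᴸ w → Linked _≢_ w
unique⇒linked []                      = []
unique⇒linked (_ ∷ [])                = [-]
unique⇒linked ((x≢y ∷ _) ∷ w!@(_ ∷ _)) = x≢y ∷ unique⇒linked w!

module _ {n} {d : ℕ} {v : Vec (Fin n) n} (v! : Unique v) where
  private l = unique⇒linked (toList-unique v!)

  𝓑⇒path : 𝓑 n d v → BallotPath d (signature (toList v))
  𝓑⇒path (bal , refl) = Equivalence.to (ballot⇔ l) bal , sym (des-signature l)

  path⇒𝓑 : BallotPath d (signature (toList v)) → 𝓑 n d v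
  path⇒𝓑 (s , refl) = Equivalence.from (ballot⇔ l) s , des-signature l

signature-++ : ∀ {n} u (x : Fin n) w →
    signature (u ++ x ∷ w) ≡ signature (u ∷ʳ x) ++ signature (x ∷ w)
signature-++ []          x w = refl
signature-++ (y ∷ [])    x w = refl
signature-++ (y ∷ z ∷ u) x w = cong (rise y z ∷_) (signature-++ (z ∷ u) x w)

signature-map : ∀ {m n} {φ : Fin m → Fin n} {w} → Linked (λ x y → rise (φ x) (φ y) ≡ rise x y) w →
  signature (map φ w) ≡ signature w
signature-map []        = refl
signature-map [-]       = refl
signature-map (eq ∷ l)  = cong₂ _∷_ eq (signature-map l)

-- Replacing a factor of a signature

infix 4 _≼_
-- The condition under which `s` may become `s′` inside any ballot path: quantifying over the
-- starting height and the continuation makes it independent of the context.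
record _≼_ (s s′ : List Bool) : Set where
  constructor _,_
  field
    above : ∀ h t → StaysAbove h (s ++ t) → StaysAbove h (s′ ++ t)
    same-falls : falls s ≡ falls s′

falls-++ : ∀ s t → falls (s ++ t) ≡ falls s + falls t
falls-++ []          t = refl
falls-++ (true  ∷ s) t = falls-++ s t
falls-++ (false ∷ s) t = cong suc (falls-++ s t)

path-≼ : ∀ {d s s′} r t → s ≼ s′ → BallotPath d (r ++ s ++ t) → BallotPath d (r ++ s′ ++ t)
path-≼ {s = s} {s′} r t (above , same) (st , refl) = go 0 r st , (begin
  falls (r ++ s′ ++ t)            ≡⟨ trans (falls-++ r _) (cong (falls r +_) (falls-++ s′ t)) ⟩
  falls r + (falls s′ + falls t)  ≡⟨ cong (λ k → falls r + (k + falls t)) same ⟨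
  falls r + (falls s + falls t)   ≡⟨ trans (falls-++ r _) (cong (falls r +_) (falls-++ s t)) ⟨
  falls (r ++ s ++ t)             ∎)
  where
  open ≡-Reasoning
  go : ∀ h r → StaysAbove h (r ++ s ++ t) → StaysAbove h (r ++ s′ ++ t)
  go h       []          st = above h t st
  go h       (true  ∷ r) st = go (suc h) r st
  go (suc h) (false ∷ r) st = go h r st

-- From height h the two paths visit h+1, h, h+1 and h+1, h+2, h+1: neither falls below 0, and they
-- end alike.
udu≼uud : true ∷ false ∷ true ∷ [] ≼ true ∷ true ∷ false ∷ []
udu≼uud = (λ _ _ → id) , refl

uud≼udu : true ∷ true ∷ false ∷ [] ≼ true ∷ false ∷ true ∷ []
uud≼udu = (λ _ _ → id) , refl

-- At height 0 both paths fall below 0; from h > 0 they visit h+1, h, h-1 and h-1, h, h-1. Hence the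
-- case split on the height.
udd≼dud : true ∷ false ∷ false ∷ [] ≼ false ∷ true ∷ false ∷ []
udd≼dud = (λ { zero _ → id ; (suc _) _ → id }) , refl

dud≼udd : false ∷ true ∷ false ∷ [] ≼ true ∷ false ∷ false ∷ []
dud≼udd = (λ { zero _ → id ; (suc _) _ → id }) , refl

-- Factors of words

infix 4 _⊑_ _⊑?_
_⊑_ : ∀ {n} → List (Fin n) → List (Fin n) → Set
_⊑_ = Infix _≡_

_⊑?_ : ∀ {n} (u w : List (Fin n)) → Dec (u ⊑ w)
u ⊑? w = infix? Fin._≟_ u w

⊑⇒++ : ∀ {n} {u w : List (Fin n)} → u ⊑ w → ∃ λ r → ∃ λ s → w ≡ r ++ u ++ s
⊑⇒++ u⊑w with MkView r eq s ← Infix.toView u⊑w with refl ← Pointwise.Pointwise-≡⇒≡ eq = r , s , refl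

++⇒⊑ : ∀ {n} {u w : List (Fin n)} r s → w ≡ r ++ u ++ s → u ⊑ w
++⇒⊑ r s refl = Infix.fromView (MkView r (Pointwise.≡⇒Pointwise-≡ refl) s)

⊑-map : ∀ {m n} (φ : Fin m → Fin n) {u w} → u ⊑ w → map φ u ⊑ map φ w
⊑-map φ {u} u⊑w with r , s , refl ← ⊑⇒++ u⊑w = ++⇒⊑ (map φ r) (map φ s)
  (trans (List.map-++ φ r (u ++ s)) (cong (map φ r ++_) (List.map-++ φ u s)))

countFactor : ∀ n → ℕ → List (Fin n) → ℕ
countFactor n d u = countPerms n (λ v → 𝓑? n d v ×-dec (u ⊑? toList v))

Touch : ∀ {n} → Fin n → Fin n → List (Fin n) → Set
Touch x y w = (x ∷ y ∷ [] ⊑ w) ⊎ (y ∷ x ∷ [] ⊑ w)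

touch? : ∀ {n} (x y : Fin n) w → Dec (Touch x y w)
touch? x y w = (x ∷ y ∷ [] ⊑? w) ⊎-dec (y ∷ x ∷ [] ⊑? w)

-- For consecutive letters `x` and `y` these are the words in which swapping them changes no ascent
-- or descent.
countApart : ∀ n → ℕ → List (Fin n) → Fin n → Fin n → ℕ
countApart n d u x y = countPerms n (λ v →
    (𝓑? n d v ×-dec (u ⊑? toList v)) ×-dec ¬? (touch? x y (toList v)))

map-injective : ∀ {m n k} {φ : Fin m → Fin n} → (∀ {x y} → φ x ≡ φ y → x ≡ y) →
    {v w : Vec (Fin m) k} →
  Vec.map φ v ≡ Vec.map φ w → v ≡ w
map-injective {φ = φ} φ-inj {v} {w} eq = lookup-ext λ i → φ-inj
  (trans (sym (Vec.lookup-map i φ v)) (trans (cong (λ u → lookup u i) eq) (Vec.lookup-map i φ w)))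

countPerms-map : ∀ {n} {P Q : Pred (Vec (Fin n) n) 0ℓ} (P? : Decidable P) (Q? : Decidable Q)
    {φ : Fin n → Fin n} →
  (∀ {x y} → φ x ≡ φ y → x ≡ y) → (∀ {v} → Unique v → P v → Q (Vec.map φ v)) →
  countPerms n P? ≤ countPerms n Q?
countPerms-map P? Q? {φ} φ-inj to = countPerms-≤ P? Q? (λ v w → w ≡ Vec.map φ v)
  (λ v! Pv → _ , Unique.map⁺ φ-inj v! , to v! Pv , refl)
  (λ eq eq′ → map-injective φ-inj (trans (sym eq) eq′))

-- Swapping two consecutive letters

module _ {n} (e e′ : Fin n) where

  transpose-at : transpose e e′ e ≡ e′
  transpose-at rewrite dec-true (e Fin.≟ e) refl = refl

  transpose-at′ : transpose e e′ e′ ≡ e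
  transpose-at′ with e′ Fin.≟ e
  ... | yes eq = eq
  ... | no _ rewrite dec-true (e′ Fin.≟ e′) refl = refl

  transpose-off : ∀ {x} → x ≢ e → x ≢ e′ → transpose e e′ x ≡ x
  transpose-off {x} x≢e x≢e′ rewrite dec-false (x Fin.≟ e) x≢e | dec-false (x Fin.≟ e′) x≢e′ = refl

  transpose-injective : ∀ {x y} → transpose e e′ x ≡ transpose e e′ y → x ≡ y
  transpose-injective = inverse⇒injective (transpose e e′) (transpose e′ e) λ x →
      transpose-inverse e′ e {x}

-- Adjacency in the order, put as indistinguishability by every third letter and thus symmetric in
-- `e` and `e′`.
Neighbours : ∀ {n} → Fin n → Fin n → Set
Neighbours {n} e e′ = ∀ (x : Fin n) → x ≢ e → x ≢ e′ → rise x e ≡ rise x e′ × rise e x ≡ rise e′ x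

neighbours-sym : ∀ {n} {e e′ : Fin n} → Neighbours e e′ → Neighbours e′ e
neighbours-sym nb x x≢e′ x≢e with p , q ← nb x x≢e x≢e′ = sym p , sym q

rise-irrefl : ∀ {n} {x : Fin n} → rise x x ≡ false
rise-irrefl = rise-≮ (<-irrefl refl)

transpose-rise : ∀ {n} {e e′ : Fin n} → Neighbours e e′ → ∀ {x y} →
  ¬ (x ≡ e × y ≡ e′) → ¬ (x ≡ e′ × y ≡ e) →
  rise (transpose e e′ x) (transpose e e′ y) ≡ rise x y
transpose-rise {e = e} {e′} nb {x} {y} ¬ee′ ¬e′e =
    go (x Fin.≟ e) (x Fin.≟ e′) (y Fin.≟ e) (y Fin.≟ e′)
  where
  go : Dec (x ≡ e) → Dec (x ≡ e′) → Dec (y ≡ e) → Dec (y ≡ e′) →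
    rise (transpose e e′ x) (transpose e e′ y) ≡ rise x y
  go (yes refl) _          (yes refl) _          = trans rise-irrefl (sym rise-irrefl)
  go (yes refl) _          _          (yes refl) = contradiction (refl , refl) ¬ee′
  go (yes refl) _          (no y≢e)   (no y≢e′)  =
    trans (cong₂ rise (transpose-at e e′) (transpose-off e e′ y≢e y≢e′))
        (sym (proj₂ (nb y y≢e y≢e′)))
  go _          (yes refl) (yes refl) _          = contradiction (refl , refl) ¬e′e
  go _          (yes refl) _          (yes refl) = trans rise-irrefl (sym rise-irrefl)
  go _          (yes refl) (no y≢e)   (no y≢e′)  =
    trans (cong₂ rise (transpose-at′ e e′) (transpose-off e e′ y≢e y≢e′)) (proj₂ (nb y y≢e y≢e′))
  go (no x≢e)   (no x≢e′)  (yes refl) _          =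
    trans (cong₂ rise (transpose-off e e′ x≢e x≢e′) (transpose-at e e′))
        (sym (proj₁ (nb x x≢e x≢e′)))
  go (no x≢e)   (no x≢e′)  _          (yes refl) =
    trans (cong₂ rise (transpose-off e e′ x≢e x≢e′) (transpose-at′ e e′)) (proj₁ (nb x x≢e x≢e′))
  go (no x≢e)   (no x≢e′)  (no y≢e)   (no y≢e′)  =
    cong₂ rise (transpose-off e e′ x≢e x≢e′) (transpose-off e e′ y≢e y≢e′)

linked-by-factors : ∀ {n} {R : Fin n → Fin n → Set} (w : List (Fin n)) →
  (∀ {x y} → x ∷ y ∷ [] ⊑ w → R x y) → Linked R w
linked-by-factors []          _ = []
linked-by-factors (x ∷ [])    _ = [-]
linked-by-factors (x ∷ y ∷ w) f =
    f (here (refl ∷ refl ∷ [])) ∷ linked-by-factors (y ∷ w) (f ∘ there)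

transpose-signature : ∀ {n} {e e′ : Fin n} → Neighbours e e′ → ∀ {w} → ¬ Touch e e′ w →
  signature (map (transpose e e′) w) ≡ signature w
transpose-signature nb {w} apart = signature-map (linked-by-factors w λ xy⊑ →
  transpose-rise nb (λ { (refl , refl) → apart (inj₁ xy⊑) })
      (λ { (refl , refl) → apart (inj₂ xy⊑) }))

-- One inequality suffices, because the statement with `e` and `e′` exchanged gives the converse.
countApart-≤ : ∀ {n} d {e e′ : Fin n} → Neighbours e e′ → ∀ u u′ → map (transpose e e′) u ≡ u′ →
  countApart n d u e e′ ≤ countApart n d u′ e′ e
countApart-≤ {n} d {e} {e′} nb u u′ refl = countPerms-map _ _ (transpose-injective e e′)
  λ { {v} v! ((𝓑v , u⊑) , apart) →
    (path⇒𝓑 (Unique.map⁺ (transpose-injective e e′) v!)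
      (subst (BallotPath d) (trans (sym (transpose-signature nb apart))
          (cong signature (sym (Vec.toList-map σ v)))) (𝓑⇒path v! 𝓑v)) ,
     subst (map σ u ⊑_) (sym (Vec.toList-map σ v)) (⊑-map σ u⊑)) ,
    λ touch → apart (back v touch) }
  where
  σ = transpose e e′
  σ⁻¹ = transpose e′ e
  undo : ∀ v → map σ⁻¹ (toList (Vec.map σ v)) ≡ toList v
  undo v = trans (cong (map σ⁻¹) (Vec.toList-map σ v)) (trans (sym (List.map-∘ (toList v)))
    (trans (List.map-cong (λ x → transpose-inverse e′ e {x}) (toList v)) (List.map-id (toList v))))
  back : ∀ v → Touch e′ e (toList (Vec.map σ v)) → Touch e e′ (toList v)
  back v (inj₁ t) = inj₁ (subst₂ _⊑_
      (cong₂ (λ x y → x ∷ y ∷ []) (transpose-at e′ e) (transpose-at′ e′ e)) (undo v) (⊑-map σ⁻¹ t))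
  back v (inj₂ t) = inj₂ (subst₂ _⊑_
      (cong₂ (λ x y → x ∷ y ∷ []) (transpose-at′ e′ e) (transpose-at e′ e)) (undo v) (⊑-map σ⁻¹ t))

countApart-transpose : ∀ {n} d {e e′ : Fin n} → Neighbours e e′ → ∀ u u′ →
  map (transpose e e′) u ≡ u′ → map (transpose e′ e) u′ ≡ u →
  countApart n d u e e′ ≡ countApart n d u′ e′ e
countApart-transpose d nb u u′ to from = ≤-antisym
  (countApart-≤ d nb u u′ to) (countApart-≤ d (neighbours-sym nb) u′ u from)

unique-split : ∀ {A : Set} {x : A} r {s} → Uniqueᴸ (r ++ x ∷ s) → All (_≢ x) r × All (_≢ x) s
unique-split []      (x∉ ∷ _)  = [] , All.map (_∘ sym) x∉
unique-split (y ∷ r) (y∉ ∷ w!) with pr , ps ← unique-split r w! = All.head (All.++⁻ʳ r y∉) ∷ pr , ps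

split-unique : ∀ {A : Set} {x : A} r r′ {s s′} → Uniqueᴸ (r ++ x ∷ s) → r ++ x ∷ s ≡ r′ ++ x ∷ s′ →
    r ≡ r′ × s ≡ s′
split-unique []      []       _         refl = refl , refl
split-unique []      (y ∷ r′) (x∉ ∷ _)  refl = contradiction refl (All.head (All.++⁻ʳ r′ x∉))
split-unique (y ∷ r) []       (y∉ ∷ _)  refl = contradiction refl (All.head (All.++⁻ʳ r y∉))
split-unique (y ∷ r) (z ∷ r′) (_ ∷ w!)  eq with refl ← List.∷-injectiveˡ eq
  with refl , refl ← split-unique r r′ w! (List.∷-injectiveʳ eq) = refl , refl

-- In its uses `u′` is `u` with one more letter at an end, the only place where `e` and `e′` can
-- touch.
countFactor-split : ∀ {n} d (u u′ : List (Fin n)) (e e′ : Fin n) →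
  (∀ {w} → Uniqueᴸ w → u ⊑ w → Touch e e′ w → u′ ⊑ w) →
  (∀ {w} → u′ ⊑ w → u ⊑ w) → (∀ {w} → u′ ⊑ w → Touch e e′ w) →
  countFactor n d u ≡ countFactor n d u′ + countApart n d u e e′
countFactor-split {n} d u u′ e e′ to from₁ from₂ = trans (countPerms-split occurs? touching?)
  (cong (_+ countApart n d u e e′) (countPerms-cong (λ v → occurs? v ×-dec touching? v) (λ v →
      𝓑? n d v ×-dec (u′ ⊑? toList v))
    (λ { v! ((𝓑v , u⊑) , touch) → 𝓑v , to (toList-unique v!) u⊑ touch })
    (λ { _ (𝓑v , u′⊑) → (𝓑v , from₁ u′⊑) , from₂ u′⊑ })))
  where
  occurs?   = λ v → 𝓑? n d v ×-dec (u ⊑? toList v)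
  touching? = λ (v : Vec (Fin n) n) → touch? e e′ (toList v)

-- The letter before `e` is `t`, so `e′` can touch `e` only from the right.
countFactor-splitʳ : ∀ {n} d (c t e e′ : Fin n) → t ≢ e′ →
  countFactor n d (c ∷ t ∷ e ∷ []) ≡ countFactor n d (c ∷ t ∷ e ∷ e′ ∷ []) + countApart n d
      (c ∷ t ∷ e ∷ []) e e′
countFactor-splitʳ d c t e e′ t≢e′ = countFactor-split d _ _ e e′ to from₁ (inj₁ ∘ from₂)
  where
  from₁ : ∀ {w} → c ∷ t ∷ e ∷ e′ ∷ [] ⊑ w → c ∷ t ∷ e ∷ [] ⊑ w
  from₁ u⊑ with r , s , eq ← ⊑⇒++ u⊑ = ++⇒⊑ r (e′ ∷ s) eq
  from₂ : ∀ {w} → c ∷ t ∷ e ∷ e′ ∷ [] ⊑ w → e ∷ e′ ∷ [] ⊑ w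
  from₂ u⊑ with r , s , eq ← ⊑⇒++ u⊑ =
      ++⇒⊑ (r ++ c ∷ t ∷ []) s (trans eq (sym (List.++-assoc r _ _)))
  to : ∀ {w} → Uniqueᴸ w → c ∷ t ∷ e ∷ [] ⊑ w → Touch e e′ w → c ∷ t ∷ e ∷ e′ ∷ [] ⊑ w
  to w! u⊑ (inj₁ ee′) with r , s , refl ← ⊑⇒++ u⊑ with r′ , s′ , eq ← ⊑⇒++ ee′
    with refl , refl ← split-unique (r ++ c ∷ t ∷ []) r′
        (subst Uniqueᴸ (sym (List.++-assoc r _ _)) w!) (trans (List.++-assoc r _ _) eq)
    = ++⇒⊑ r s′ refl
  to w! u⊑ (inj₂ e′e) with r , s , refl ← ⊑⇒++ u⊑ with r′ , s′ , eq ← ⊑⇒++ e′e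
    with eq′ , _ ← split-unique (r ++ c ∷ t ∷ []) (r′ ++ e′ ∷ [])
        (subst Uniqueᴸ (sym (List.++-assoc r _ _)) w!)
                     (trans (List.++-assoc r _ _) (trans eq (sym (List.++-assoc r′ _ _))))
    = contradiction (List.∷ʳ-injectiveʳ (r ++ c ∷ []) r′ (trans (List.++-assoc r _ _) eq′)) t≢e′

countFactor-splitˡ : ∀ {n} d (e′ e t c : Fin n) → t ≢ e′ →
  countFactor n d (e ∷ t ∷ c ∷ []) ≡ countFactor n d (e′ ∷ e ∷ t ∷ c ∷ []) + countApart n d
      (e ∷ t ∷ c ∷ []) e e′
countFactor-splitˡ d e′ e t c t≢e′ = countFactor-split d _ _ e e′ to from₁ (inj₂ ∘ from₂)
  where
  from₁ : ∀ {w} → e′ ∷ e ∷ t ∷ c ∷ [] ⊑ w → e ∷ t ∷ c ∷ [] ⊑ w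
  from₁ u⊑ with r , s , eq ← ⊑⇒++ u⊑ = ++⇒⊑ (r ∷ʳ e′) s (trans eq (sym (List.++-assoc r _ _)))
  from₂ : ∀ {w} → e′ ∷ e ∷ t ∷ c ∷ [] ⊑ w → e′ ∷ e ∷ [] ⊑ w
  from₂ u⊑ with r , s , eq ← ⊑⇒++ u⊑ = ++⇒⊑ r (t ∷ c ∷ s) eq
  to : ∀ {w} → Uniqueᴸ w → e ∷ t ∷ c ∷ [] ⊑ w → Touch e e′ w → e′ ∷ e ∷ t ∷ c ∷ [] ⊑ w
  to w! u⊑ (inj₁ ee′) with r , s , refl ← ⊑⇒++ u⊑ with r′ , s′ , eq ← ⊑⇒++ ee′
    with _ , eq′ ← split-unique r r′ w! eq = contradiction (List.∷-injectiveˡ eq′) t≢e′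
  to w! u⊑ (inj₂ e′e) with r , s , refl ← ⊑⇒++ u⊑ with r′ , s′ , eq ← ⊑⇒++ e′e
    with refl , _ ← split-unique r (r′ ∷ʳ e′) w! (trans eq (sym (List.++-assoc r′ _ _)))
    = ++⇒⊑ r′ s (List.++-assoc r′ _ _)

-- Relabelling around a block of four letters

module _ {n} {φ : Fin n → Fin n} (φ-inj : ∀ {x y} → φ x ≡ φ y → x ≡ y) {e₁ e₂ e₃ e₄ : Fin n}
  (monotone : ∀ {x y} → x ≢ e₂ → x ≢ e₃ → y ≢ e₂ → y ≢ e₃ → rise (φ x) (φ y) ≡ rise x y) where

  private
    signature-map-off : ∀ {w} → All (_≢ e₂) w → All (_≢ e₃) w → signature (map φ w) ≡ signature w
    signature-map-off {[]}        _            _            = refl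
    signature-map-off {x ∷ []}    _            _            = refl
    signature-map-off {x ∷ y ∷ w} (x₂ ∷ y₂ ∷ p) (x₃ ∷ y₃ ∷ q) =
      cong₂ _∷_ (monotone x₂ x₃ y₂ y₃) (signature-map-off (y₂ ∷ p) (y₃ ∷ q))

  -- Monotonicity fails at most at `e₂` and `e₃`, which a repetition-free word contains only inside
  -- the block. So only the three steps of the block can change in the signature, and `_≼_` permits
  -- that change.
  countFactor-block-≤ : ∀ d →
    rise e₁ e₂ ∷ rise e₂ e₃ ∷ rise e₃ e₄ ∷ [] ≼ rise (φ e₁) (φ e₂) ∷ rise (φ e₂) (φ e₃) ∷ rise
        (φ e₃) (φ e₄) ∷ [] →
    countFactor n d (e₁ ∷ e₂ ∷ e₃ ∷ e₄ ∷ []) ≤ countFactor n d (φ e₁ ∷ φ e₂ ∷ φ e₃ ∷ φ e₄ ∷ [])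
  countFactor-block-≤ d s≼s′ = countPerms-map _ _ φ-inj λ { {v} v! (𝓑v , u⊑) →
    let r , s , eq = ⊑⇒++ u⊑ in
    path⇒𝓑 (Unique.map⁺ φ-inj v!) (subst (BallotPath d ∘ signature)
        (trans (cong (map φ) (sym eq)) (sym (Vec.toList-map φ v)))
      (block r s (subst Uniqueᴸ eq (toList-unique v!))
          (subst (BallotPath d ∘ signature) eq (𝓑⇒path v! 𝓑v)))) ,
    subst (_ ⊑_) (sym (Vec.toList-map φ v)) (⊑-map φ u⊑) }
    where
    block : ∀ r s → Uniqueᴸ (r ++ e₁ ∷ e₂ ∷ e₃ ∷ e₄ ∷ s) →
      BallotPath d (signature (r ++ e₁ ∷ e₂ ∷ e₃ ∷ e₄ ∷ s)) →
      BallotPath d (signature (map φ (r ++ e₁ ∷ e₂ ∷ e₃ ∷ e₄ ∷ s)))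
    block r s w! path = subst (BallotPath d) (sym map-eq)
      (path-≼ (signature (r ∷ʳ e₁)) (signature (e₄ ∷ s)) s≼s′
          (subst (BallotPath d) (signature-++ r e₁ _) path))
      where
      split₂ = unique-split (r ∷ʳ e₁) (subst Uniqueᴸ (sym (List.++-assoc r _ _)) w!)
      split₃ = unique-split (r ++ e₁ ∷ e₂ ∷ []) (subst Uniqueᴸ (sym (List.++-assoc r _ _)) w!)
      before : signature (map φ (r ∷ʳ e₁)) ≡ signature (r ∷ʳ e₁)
      before = signature-map-off (proj₁ split₂)
        (All.++⁺ (All.++⁻ˡ r (proj₁ split₃)) (All.head (All.++⁻ʳ r (proj₁ split₃)) ∷ []))
      after : signature (map φ (e₄ ∷ s)) ≡ signature (e₄ ∷ s)
      after = signature-map-off (All.tail (proj₂ split₂)) (proj₂ split₃)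
      map-eq : signature (map φ (r ++ e₁ ∷ e₂ ∷ e₃ ∷ e₄ ∷ s)) ≡ signature (r ∷ʳ e₁) ++
        (rise (φ e₁) (φ e₂) ∷ rise (φ e₂) (φ e₃) ∷ rise (φ e₃) (φ e₄) ∷ []) ++ signature (e₄ ∷ s)
      map-eq = begin
        signature (map φ (r ++ e₁ ∷ e₂ ∷ e₃ ∷ e₄ ∷ s))
          ≡⟨ cong signature (List.map-++ φ r _) ⟩
        signature (map φ r ++ φ e₁ ∷ map φ (e₂ ∷ e₃ ∷ e₄ ∷ s))
          ≡⟨ signature-++ (map φ r) (φ e₁) _ ⟩
        signature (map φ r ∷ʳ φ e₁) ++ middle ++ signature (map φ (e₄ ∷ s))
          ≡⟨ cong₂ (λ b a → b ++ middle ++ a)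
              (trans (cong signature (sym (List.map-++ φ r (e₁ ∷ [])))) before) after ⟩
        signature (r ∷ʳ e₁) ++ middle ++ signature (e₄ ∷ s) ∎
        where
        open ≡-Reasoning
        middle = rise (φ e₁) (φ e₂) ∷ rise (φ e₂) (φ e₃) ∷ rise (φ e₃) (φ e₄) ∷ []

-- In the matching  i n j (j+1) ↔ i (i+1) n (j+1)  take q = j and p = i+1; in
-- i n (j+1) j ↔ (i+1) i n (j+1)  take q = j+1 and p = i.
relabel : ∀ {N} (q p : Fin (suc N)) → Fin (suc (suc N)) → Fin (suc (suc N))
relabel q p x with view x
... | ‵fromℕ     = inject₁ p
... | ‵inject₁ i with q Fin.≟ i
...   | yes _   = top
...   | no q≢i = inject₁ (punchIn p (punchOut q≢i))

module _ {N} (q p : Fin (suc N)) where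

  relabel-top : relabel q p top ≡ inject₁ p
  relabel-top rewrite view-fromℕ (suc N) = refl

  relabel-pivot : relabel q p (inject₁ q) ≡ top
  relabel-pivot rewrite view-inject₁ q with q Fin.≟ q
  ... | yes _  = refl
  ... | no q≢q = contradiction refl q≢q

  relabel-off : ∀ {i} (q≢i : q ≢ i) → relabel q p (inject₁ i) ≡ inject₁ (punchIn p (punchOut q≢i))
  relabel-off {i} q≢i rewrite view-inject₁ i with q Fin.≟ i
  ... | yes q≡i = contradiction q≡i q≢i
  ... | no  _   = cong (inject₁ ∘ punchIn p) (Fin.punchOut-cong q refl)

-- Closing the gap at `q` and opening one at `p` is undone with `p` and `q` exchanged; likewise `q`
-- goes to `top` and `top` to `p`.
relabel-inverse : ∀ {N} (q p : Fin (suc N)) x → relabel p q (relabel q p x) ≡ x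
relabel-inverse q p x with view x
... | ‵fromℕ     = relabel-pivot p q
... | ‵inject₁ i with q Fin.≟ i
...   | yes refl = relabel-top p q
...   | no q≢i   = trans (relabel-off p q (Fin.punchInᵢ≢i p (punchOut q≢i) ∘ sym))
  (cong inject₁ (trans (cong (punchIn q) (Fin.punchOut-punchIn p)) (Fin.punchIn-punchOut q≢i)))

relabel-injective : ∀ {N} (q p : Fin (suc N)) {x y} → relabel q p x ≡ relabel q p y → x ≡ y
relabel-injective q p = inverse⇒injective (relabel q p) (relabel p q) (relabel-inverse q p)

relabel-monotone : ∀ {N} (q p : Fin (suc N)) {x y} → x ≢ inject₁ q → x ≢ top → y ≢ inject₁ q →
    y ≢ top →
  rise (relabel q p x) (relabel q p y) ≡ rise x y
relabel-monotone q p x≢q x≢⊤ y≢q y≢⊤ with i , refl ← ≢top⇒inject₁ x≢⊤ with j , refl ←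
    ≢top⇒inject₁ y≢⊤ = begin
  rise (relabel q p (inject₁ i)) (relabel q p (inject₁ j))
    ≡⟨ cong₂ rise (relabel-off q p q≢i) (relabel-off q p q≢j) ⟩
  rise (inject₁ (punchIn p (punchOut q≢i))) (inject₁ (punchIn p (punchOut q≢j)))
    ≡⟨ rise-cong (λ lt → inject₁-mono-< (≰⇒> λ le → <⇒≱ (inject₁-cancel-< lt)
                    (Fin.punchOut-cancel-≤ q≢j q≢i (Fin.punchIn-cancel-≤ p _ _ le))))
                 (λ lt → inject₁-mono-< (≰⇒> λ le → <⇒≱ (inject₁-cancel-< lt)
                    (Fin.punchIn-mono-≤ p _ _ (Fin.punchOut-mono-≤ q≢j q≢i le)))) ⟩
  rise (inject₁ i) (inject₁ j) ∎
  where
  open ≡-Reasoning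
  q≢i : q ≢ i
  q≢i refl = x≢q refl
  q≢j : q ≢ j
  q≢j refl = y≢q refl

module _ {N} (q p : Fin (suc N)) where

  -- The premises on `x` say that the inner letters of the blocks include `top` and the pivot, which
  -- is `q` before and `p` after relabelling. The converse inequality uses the inverse
  -- `relabel p q`.
  countFactor-relabel : ∀ d {e₁ e₂ e₃ e₄ f₁ f₂ f₃ f₄ s s′} →
    relabel q p e₁ ≡ f₁ → relabel q p e₂ ≡ f₂ → relabel q p e₃ ≡ f₃ → relabel q p e₄ ≡ f₄ →
    (∀ {x} → x ≢ e₂ → x ≢ e₃ → x ≢ inject₁ q × x ≢ top) →
    (∀ {x} → x ≢ f₂ → x ≢ f₃ → x ≢ inject₁ p × x ≢ top) →
    signature (e₁ ∷ e₂ ∷ e₃ ∷ e₄ ∷ []) ≡ s → signature (f₁ ∷ f₂ ∷ f₃ ∷ f₄ ∷ []) ≡ s′ → s ≼ s′ →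
        s′ ≼ s →
    countFactor (suc (suc N)) d (e₁ ∷ e₂ ∷ e₃ ∷ e₄ ∷ []) ≡
        countFactor (suc (suc N)) d (f₁ ∷ f₂ ∷ f₃ ∷ f₄ ∷ [])
  countFactor-relabel d {e₁} {e₂} {e₃} {e₄} refl refl refl refl e-off f-off refl refl s≼s′ s′≼s =
      ≤-antisym
    (countFactor-block-≤ (relabel-injective q p)
      (λ x₂ x₃ y₂ y₃ → let x≢q , x≢⊤ = e-off x₂ x₃ ; y≢q , y≢⊤ =
                             e-off y₂ y₃ in relabel-monotone q p x≢q x≢⊤ y≢q y≢⊤)
      d s≼s′)
    (subst (countFactor _ d (map φ es) ≤_) (cong (countFactor _ d) ψφes)
      (countFactor-block-≤ (relabel-injective p q)
        (λ x₂ x₃ y₂ y₃ → let x≢q , x≢⊤ = f-off x₂ x₃ ; y≢q , y≢⊤ =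
                               f-off y₂ y₃ in relabel-monotone p q x≢q x≢⊤ y≢q y≢⊤)
        d (subst (signature (map φ es) ≼_) (cong signature (sym ψφes)) s′≼s)))
    where
    φ = relabel q p
    ψ = relabel p q
    es = e₁ ∷ e₂ ∷ e₃ ∷ e₄ ∷ []
    ψφes : map ψ (map φ es) ≡ es
    ψφes = trans (sym (List.map-∘ {g = ψ} {φ} es))
        (trans (List.map-cong (relabel-inverse q p) es) (List.map-id es))

-- The four block matchings

-- The consecutive letters i and i+1 as the two sides of the toric identity contain them, embedded
-- below `top`.
low high : ∀ {M} → Fin M → Fin (suc (suc M))
low  a = inject₁ (inject₁ a)
high a = inject₁ (suc a)

toℕ-low : ∀ {M} (a : Fin M) → toℕ (low a) ≡ toℕ a
toℕ-low a = trans (Fin.toℕ-inject₁ (inject₁ a)) (Fin.toℕ-inject₁ a)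

toℕ-high : ∀ {M} (a : Fin M) → toℕ (high a) ≡ suc (toℕ a)
toℕ-high a = Fin.toℕ-inject₁ (suc a)

consecutive⇒neighbours : ∀ {n} {e e′ : Fin n} → toℕ e′ ≡ suc (toℕ e) → Neighbours e e′
consecutive⇒neighbours {e = e} {e′} e′≡1+e x x≢e x≢e′ =
  rise-cong (λ x<e′ → ≤∧≢⇒< (s≤s⁻¹ (subst (toℕ x <_) e′≡1+e x<e′)) (x≢e ∘ Fin.toℕ-injective))
            (λ x<e → subst (toℕ x <_) (sym e′≡1+e) (m<n⇒m<1+n x<e)) ,
  rise-cong (λ e′<x → <-trans (n<1+n _) (subst (_< toℕ x) e′≡1+e e′<x))
            (λ e<x → ≤∧≢⇒< (subst (_≤ toℕ x) (sym e′≡1+e) e<x) (x≢e′ ∘ sym ∘ Fin.toℕ-injective))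

low-high-neighbours : ∀ {M} (a : Fin M) → Neighbours (low a) (high a)
low-high-neighbours a = consecutive⇒neighbours (trans (toℕ-high a) (cong suc (sym (toℕ-low a))))

punchOut-inject₁-suc : ∀ {n} (y : Fin n) (y≢ : inject₁ y ≢ suc y) → punchOut y≢ ≡ y
punchOut-inject₁-suc zero    _  = refl
punchOut-inject₁-suc (suc y) y≢ = cong suc (punchOut-inject₁-suc y _)

punchOut-suc-inject₁ : ∀ {n} (y : Fin n) (y≢ : suc y ≢ inject₁ y) → punchOut y≢ ≡ y
punchOut-suc-inject₁ zero    _  = refl
punchOut-suc-inject₁ (suc y) y≢ = cong suc (punchOut-suc-inject₁ y _)

-- Moving the gap from y to x+1 raises only the letters strictly between x and y, so x and y+1 stay.
shift-fix-low : ∀ {M} {x y : Fin M} → x Fin.< y → (y≢x : inject₁ y ≢ inject₁ x) →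
  punchIn (suc x) (punchOut y≢x) ≡ inject₁ x
shift-fix-low {x = zero}  {suc y} _   y≢x = refl
shift-fix-low {x = suc x} {suc y} x<y y≢x = cong suc (shift-fix-low (s≤s⁻¹ x<y) _)

shift-fix-high : ∀ {M} {x y : Fin M} → x Fin.< y → (y≢y : inject₁ y ≢ suc y) →
  punchIn (suc x) (punchOut y≢y) ≡ suc y
shift-fix-high {x = zero}  {suc y} _   y≢y = cong (λ z → suc (suc z)) (punchOut-inject₁-suc y _)
shift-fix-high {x = suc x} {suc y} x<y y≢y = cong suc (shift-fix-high (s≤s⁻¹ x<y) _)

-- Moving the gap from y+1 to x raises all letters from x to y by one, the end points included.
shift-raise-left : ∀ {M} {x y : Fin M} → x Fin.< y → (y≢x : suc y ≢ inject₁ x) →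
  punchIn (inject₁ x) (punchOut y≢x) ≡ suc x
shift-raise-left {x = zero}  {suc y} _   y≢x = refl
shift-raise-left {x = suc x} {suc y} x<y y≢x = cong suc (shift-raise-left (s≤s⁻¹ x<y) _)

shift-raise-right : ∀ {M} {x y : Fin M} → x Fin.< y → (y≢y : suc y ≢ inject₁ y) →
  punchIn (inject₁ x) (punchOut y≢y) ≡ suc y
shift-raise-right {x = zero}  {suc y} _   y≢y = cong (λ z → suc (suc z)) (punchOut-suc-inject₁ y _)
shift-raise-right {x = suc x} {suc y} x<y y≢y = cong suc (shift-raise-right (s≤s⁻¹ x<y) _)

module _ {M} {x y : Fin M} (x<y : x Fin.< y) (d : ℕ) where

  private
    n : ℕ
    n = suc (suc M)
    topₙ : Fin n
    topₙ = top
    y≢x : inject₁ y ≢ inject₁ x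
    y≢x eq = <⇒≢ x<y (cong toℕ (sym (Fin.inject₁-injective eq)))
    y≢y⁺ : inject₁ y ≢ suc y
    y≢y⁺ eq = <⇒≢ (n<1+n (toℕ y)) (trans (sym (Fin.toℕ-inject₁ y)) (cong toℕ eq))
    y⁺≢x : suc y ≢ inject₁ x
    y⁺≢x eq = <⇒≢ (<-trans x<y (n<1+n _)) (sym (trans (cong toℕ eq) (Fin.toℕ-inject₁ x)))

    fix-low : relabel (inject₁ y) (suc x) (low x) ≡ low x
    fix-low = trans (relabel-off (inject₁ y) (suc x) y≢x) (cong inject₁ (shift-fix-low x<y y≢x))
    fix-high : relabel (inject₁ y) (suc x) (high y) ≡ high y
    fix-high = trans (relabel-off (inject₁ y) (suc x) y≢y⁺) (cong inject₁ (shift-fix-high x<y y≢y⁺))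
    raise-left : relabel (suc y) (inject₁ x) (low x) ≡ high x
    raise-left = trans (relabel-off (suc y) (inject₁ x) y⁺≢x)
        (cong inject₁ (shift-raise-left x<y y⁺≢x))
    raise-right : relabel (suc y) (inject₁ x) (low y) ≡ high y
    raise-right = trans (relabel-off (suc y) (inject₁ x) (y≢y⁺ ∘ sym))
        (cong inject₁ (shift-raise-right x<y (y≢y⁺ ∘ sym)))

    to-top : ∀ {i : Fin (suc M)} → rise (inject₁ i) topₙ ≡ true
    to-top {i} = rise-< (inject₁<top i)
    from-top : ∀ {i : Fin n} → rise topₙ i ≡ false
    from-top {i} = rise-≮ (top≮ i)
    low-high : ∀ {a : Fin M} → low a Fin.< high a
    low-high {a} = ≤-reflexive (trans (cong suc (toℕ-low a)) (sym (toℕ-high a)))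
    up-step : ∀ {a : Fin M} → rise (low a) (high a) ≡ true
    up-step = rise-< low-high
    down-step : ∀ {a : Fin M} → rise (high a) (low a) ≡ false
    down-step = rise-≮ (<-asym low-high)

    signature₄ : ∀ {n} {e₁ e₂ e₃ e₄ : Fin n} {a b c} → rise e₁ e₂ ≡ a → rise e₂ e₃ ≡ b →
        rise e₃ e₄ ≡ c →
      signature (e₁ ∷ e₂ ∷ e₃ ∷ e₄ ∷ []) ≡ a ∷ b ∷ c ∷ []
    signature₄ refl refl refl = refl

  block-udu-uud : countFactor n d (low x ∷ top ∷ low y ∷ high y ∷ []) ≡
      countFactor n d (low x ∷ high x ∷ top ∷ high y ∷ [])
  block-udu-uud = countFactor-relabel (inject₁ y) (suc x) d
    fix-low (relabel-top (inject₁ y) (suc x)) (relabel-pivot (inject₁ y) (suc x)) fix-high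
        (λ ≢t ≢q → ≢q , ≢t) _,_
    (signature₄ to-top from-top up-step) (signature₄ up-step to-top from-top) udu≼uud uud≼udu

  block-udd-dud : countFactor n d (low x ∷ top ∷ high y ∷ low y ∷ []) ≡
      countFactor n d (high x ∷ low x ∷ top ∷ high y ∷ [])
  block-udd-dud = countFactor-relabel (suc y) (inject₁ x) d
    raise-left (relabel-top (suc y) (inject₁ x)) (relabel-pivot (suc y) (inject₁ x)) raise-right
        (λ ≢t ≢q → ≢q , ≢t) _,_
    (signature₄ to-top from-top down-step) (signature₄ down-step to-top from-top) udd≼dud dud≼udd

  -- The blocks of `block-udu-uud` read backwards, under the same relabelling; `block-uud-udu`
  -- likewise reverses `block-udd-dud`. They serve the case i > j, with `y` for i and `x` for j.
  block-dud-udd : countFactor n d (high y ∷ low y ∷ top ∷ low x ∷ []) ≡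
      countFactor n d (high y ∷ top ∷ high x ∷ low x ∷ [])
  block-dud-udd = countFactor-relabel (inject₁ y) (suc x) d
    fix-high (relabel-pivot (inject₁ y) (suc x)) (relabel-top (inject₁ y) (suc x)) fix-low _,_
        (λ ≢t ≢p → ≢p , ≢t)
    (signature₄ down-step to-top from-top) (signature₄ to-top from-top down-step) dud≼udd udd≼dud

  block-uud-udu : countFactor n d (low y ∷ high y ∷ top ∷ low x ∷ []) ≡
      countFactor n d (high y ∷ top ∷ low x ∷ high x ∷ [])
  block-uud-udu = countFactor-relabel (suc y) (inject₁ x) d
    raise-right (relabel-pivot (suc y) (inject₁ x)) (relabel-top (suc y) (inject₁ x)) raise-left
        _,_ (λ ≢t ≢p → ≢p , ≢t)
    (signature₄ up-step to-top from-top) (signature₄ to-top from-top up-step) uud≼udu udu≼uud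

b-through : ∀ {N} → ℕ → Fin N → Fin N → ℕ
b-through {N} d i j = countFactor (suc N) d (inject₁ i ∷ top ∷ inject₁ j ∷ [])

-- `Y` is the intermediate count, with only the greater neighbour raised; its two decompositions
-- force `S` and `T` to agree.
exchange : ∀ {X Y Z} A B S T → X ≡ A + S → Y ≡ B + S → Y ≡ B + T → Z ≡ A + T → X ≡ Z
exchange A B S T refl refl Y≡ refl = cong (A +_) (+-cancelˡ-≡ B S T Y≡)

-- Ballot permutations by the neighbours of the greatest letter

countApart-transposeʳ : ∀ {n} d {c t e e′ : Fin n} → Neighbours e e′ → c ≢ e → c ≢ e′ → t ≢ e →
    t ≢ e′ →
  countApart n d (c ∷ t ∷ e ∷ []) e e′ ≡ countApart n d (c ∷ t ∷ e′ ∷ []) e′ e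
countApart-transposeʳ d {c} {t} {e} {e′} nb c≢e c≢e′ t≢e t≢e′ = countApart-transpose d nb _ _
  (cong₂ _∷_ (transpose-off e e′ c≢e c≢e′)
      (cong₂ _∷_ (transpose-off e e′ t≢e t≢e′) (cong (_∷ []) (transpose-at e e′))))
  (cong₂ _∷_ (transpose-off e′ e c≢e′ c≢e)
      (cong₂ _∷_ (transpose-off e′ e t≢e′ t≢e) (cong (_∷ []) (transpose-at e′ e))))

countApart-transposeˡ : ∀ {n} d {e e′ t c : Fin n} → Neighbours e e′ → c ≢ e → c ≢ e′ → t ≢ e →
    t ≢ e′ →
  countApart n d (e ∷ t ∷ c ∷ []) e e′ ≡ countApart n d (e′ ∷ t ∷ c ∷ []) e′ e
countApart-transposeˡ d {e} {e′} {t} {c} nb c≢e c≢e′ t≢e t≢e′ = countApart-transpose d nb _ _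
  (cong₂ _∷_ (transpose-at e e′)
      (cong₂ _∷_ (transpose-off e e′ t≢e t≢e′) (cong (_∷ []) (transpose-off e e′ c≢e c≢e′))))
  (cong₂ _∷_ (transpose-at e′ e)
      (cong₂ _∷_ (transpose-off e′ e t≢e′ t≢e) (cong (_∷ []) (transpose-off e′ e c≢e′ c≢e))))

module _ {M} (d : ℕ) {a b : Fin M} where

  private
    n : ℕ
    n = suc (suc M)
    toℕ-≢ : ∀ {x y : Fin (suc (suc M))} {k l} → toℕ x ≡ k → toℕ y ≡ l → k ≢ l → x ≢ y
    toℕ-≢ x≡k y≡l k≢l refl = k≢l (trans (sym x≡k) y≡l)

  b-through-toric-< : a Fin.< b → b-through d (inject₁ a) (inject₁ b) ≡ b-through d (suc a) (suc b)
  b-through-toric-< a<b = exchange A B S T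
    (trans (countFactor-splitʳ d (low a) top (low b) (high b) top≢inject₁)
        (cong (_+ S) (block-udu-uud a<b d)))
    -- The intermediate factor `low a`, `top`, `high b`, split here by contact of the right pair and
    -- in the next argument by contact of the left pair.
    (trans (countFactor-splitʳ d (low a) top (high b) (low b) top≢inject₁)
        (cong₂ _+_ (block-udd-dud a<b d)
      (sym (countApart-transposeʳ d (low-high-neighbours b)
        (toℕ-≢ (toℕ-low a) (toℕ-low b) (<⇒≢ a<b))
            (toℕ-≢ (toℕ-low a) (toℕ-high b) (<⇒≢ (<-trans a<b (n<1+n _))))
        top≢inject₁ top≢inject₁))))
    (countFactor-splitˡ d (high a) (low a) top (high b) top≢inject₁)
    (trans (countFactor-splitˡ d (low a) (high a) top (high b) top≢inject₁) (cong (A +_)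
      (sym (countApart-transposeˡ d (low-high-neighbours a)
        (toℕ-≢ (toℕ-high b) (toℕ-low a) (>⇒≢ (<-trans a<b (n<1+n _))))
            (toℕ-≢ (toℕ-high b) (toℕ-high a) (>⇒≢ (s≤s a<b)))
        top≢inject₁ top≢inject₁))))
    where
    A = countFactor n d (low a ∷ high a ∷ top ∷ high b ∷ [])
    S = countApart n d (low a ∷ top ∷ low b ∷ []) (low b) (high b)
    B = countFactor n d (high a ∷ low a ∷ top ∷ high b ∷ [])
    T = countApart n d (low a ∷ top ∷ high b ∷ []) (low a) (high a)

  b-through-toric-> : b Fin.< a → b-through d (inject₁ a) (inject₁ b) ≡ b-through d (suc a) (suc b)
  b-through-toric-> b<a = exchange A B S T
    (trans (countFactor-splitˡ d (high a) (low a) top (low b) top≢inject₁)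
        (cong (_+ S) (block-dud-udd b<a d)))
    -- Now the left neighbour is the greater one and moves first: the intermediate factor is
    -- `high a`, `top`, `low b`.
    (trans (countFactor-splitˡ d (low a) (high a) top (low b) top≢inject₁)
        (cong₂ _+_ (block-uud-udu b<a d)
      (sym (countApart-transposeˡ d (low-high-neighbours a)
        (toℕ-≢ (toℕ-low b) (toℕ-low a) (<⇒≢ b<a))
            (toℕ-≢ (toℕ-low b) (toℕ-high a) (<⇒≢ (<-trans b<a (n<1+n _))))
        top≢inject₁ top≢inject₁))))
    (countFactor-splitʳ d (high a) top (low b) (high b) top≢inject₁)
    (trans (countFactor-splitʳ d (high a) top (high b) (low b) top≢inject₁) (cong (A +_)
      (sym (countApart-transposeʳ d (low-high-neighbours b)
        (toℕ-≢ (toℕ-high a) (toℕ-low b) (>⇒≢ (<-trans b<a (n<1+n _))))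
            (toℕ-≢ (toℕ-high a) (toℕ-high b) (>⇒≢ (s≤s b<a)))
        top≢inject₁ top≢inject₁))))
    where
    A = countFactor n d (high a ∷ top ∷ high b ∷ low b ∷ [])
    S = countApart n d (low a ∷ top ∷ low b ∷ []) (low a) (high a)
    B = countFactor n d (high a ∷ top ∷ low b ∷ high b ∷ [])
    T = countApart n d (high a ∷ top ∷ low b ∷ []) (low b) (high b)

b-through-diagonal : ∀ {N} d (i : Fin N) → b-through d i i ≡ 0
b-through-diagonal {N} d i = countPerms-empty
  (λ v → 𝓑? (suc N) d v ×-dec (inject₁ i ∷ top ∷ inject₁ i ∷ [] ⊑? toList v)) λ v! (_ , iti) →
      absurd (toList-unique v!) iti
  where
  absurd : ∀ {w} → Uniqueᴸ w → ¬ (inject₁ i ∷ top ∷ inject₁ i ∷ [] ⊑ w)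
  absurd w! iti with r , s , refl ← ⊑⇒++ iti with _ , (_ ∷ i≢i ∷ _) ← unique-split r w! = i≢i refl

b-through-toric : ∀ {M} d (a b : Fin M) → b-through d (inject₁ a) (inject₁ b) ≡
    b-through d (suc a) (suc b)
b-through-toric d a b with Fin.<-cmp a b
... | tri< a<b _ _  = b-through-toric-< d a<b
... | tri> _ _ b<a  = b-through-toric-> d b<a
... | tri≈ _ refl _ = trans (b-through-diagonal d (inject₁ a)) (sym (b-through-diagonal d (suc a)))

bᶠ≡b-through : ∀ {N} d (i j : Fin N) → bᶠ (suc N) d (suc (toℕ i)) (suc (toℕ j)) ≡ b-through d i j
bᶠ≡b-through {N} d i j = countPerms-cong _ (λ v →
    𝓑? (suc N) d v ×-dec (inject₁ i ∷ top ∷ inject₁ j ∷ [] ⊑? toList v))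
  (λ _ (𝓑v , factor) → 𝓑v , to factor) (λ _ (𝓑v , i⊤j) → 𝓑v , from i⊤j)
  where
  to : ∀ {w : List (Fin (suc N))} →
      Infix (λ a x → a ≡ letter x) (suc (toℕ i) ∷ suc N ∷ suc (toℕ j) ∷ []) w →
    inject₁ i ∷ top ∷ inject₁ j ∷ [] ⊑ w
  to factor with MkView r (i≡ ∷ top≡ ∷ j≡ ∷ []) s ← Infix.toView factor = ++⇒⊑ r s
    (cong (r ++_) (cong₂ _∷_ (inject₁≡ i≡)
        (cong₂ _∷_ (Fin.toℕ-injective (trans (sym (suc-injective top≡)) (sym (Fin.toℕ-fromℕ N))))
      (cong (_∷ s) (inject₁≡ j≡)))))
    where
    inject₁≡ : ∀ {k : Fin N} {x} → suc (toℕ k) ≡ letter x → x ≡ inject₁ k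
    inject₁≡ {k} eq = Fin.toℕ-injective (trans (sym (suc-injective eq)) (sym (Fin.toℕ-inject₁ k)))
  from : ∀ {w : List (Fin (suc N))} → inject₁ i ∷ top ∷ inject₁ j ∷ [] ⊑ w →
    Infix (λ a x → a ≡ letter x) (suc (toℕ i) ∷ suc N ∷ suc (toℕ j) ∷ []) w
  from i⊤j with r , s , refl ← ⊑⇒++ i⊤j = r ++ⁱ here
    (cong suc (sym (Fin.toℕ-inject₁ i)) ∷ cong suc (sym (Fin.toℕ-fromℕ N)) ∷ cong suc
        (sym (Fin.toℕ-inject₁ j)) ∷ [])

rise-inject₁ : ∀ {n} (i j : Fin n) → rise (inject₁ i) (inject₁ j) ≡ rise i j
rise-inject₁ i j = rise-cong inject₁-mono-< inject₁-cancel-<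

signature-extend : ∀ {n} (x : Fin n) w → signature (map inject₁ (x ∷ w) ∷ʳ top) ≡
    signature (x ∷ w) ++ true ∷ []
signature-extend x []      = cong (_∷ []) (rise-< (inject₁<top x))
signature-extend x (y ∷ w) = cong₂ _∷_ (rise-inject₁ x y) (signature-extend y w)

-- The appended greatest letter contributes at most a final ascent, which adds no fall and cannot
-- violate the ballot condition.
ballotPath-extend : ∀ {n d} (w : List (Fin n)) →
  BallotPath d (signature (map inject₁ w ∷ʳ top)) ⇔ BallotPath d (signature w)
ballotPath-extend []      = mk⇔ id id
ballotPath-extend {d = d} (x ∷ w) rewrite signature-extend x w = mk⇔
  (λ { (st , refl) → from-above 0 s st , sym falls-eq })
  (λ { (st , refl) → to-above 0 s st , falls-eq })
  where
  s = signature (x ∷ w)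
  falls-eq : falls (s ++ true ∷ []) ≡ falls s
  falls-eq = trans (falls-++ s (true ∷ [])) (+-identityʳ (falls s))
  to-above : ∀ h s → StaysAbove h s → StaysAbove h (s ++ true ∷ [])
  to-above h       []          _  = tt
  to-above h       (true  ∷ s) st = to-above (suc h) s st
  to-above (suc h) (false ∷ s) st = to-above h s st
  from-above : ∀ h s → StaysAbove h (s ++ true ∷ []) → StaysAbove h s
  from-above h       []          _  = tt
  from-above h       (true  ∷ s) st = from-above (suc h) s st
  from-above (suc h) (false ∷ s) st = from-above h s st

toList-extend : ∀ {n} (v : Vec (Fin n) n) → toList (extend v) ≡ map inject₁ (toList v) ∷ʳ top
toList-extend v = trans (Vec.toList-∷ʳ top (Vec.map inject₁ v))
    (cong (_∷ʳ top) (Vec.toList-map inject₁ v))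

toList-last : ∀ {A : Set} {n} (v : Vec A (suc n)) → ∃ λ r → toList v ≡ r ∷ʳ lookup v top
toList-last (x Vec.∷ Vec.[])        = [] , refl
toList-last (x Vec.∷ v@(_ Vec.∷ _)) with r , eq ← toList-last v = x ∷ r , cong (x ∷_) eq

b-suc : ∀ N d → b (suc N) d ≡ b N d + ∑ {N} λ i → ∑ {N} λ j → b-through d i j
b-suc N d = trans (countPerms-split (𝓑? (suc N) d) top-last?) (cong₂ _+_
  (countPerms-extend (𝓑? N d) (𝓑? (suc N) d)
    (λ {v} v! 𝓑v → path⇒𝓑 (extend-unique v!)
        (subst (BallotPath d ∘ signature) (sym (toList-extend v))
      (Equivalence.from (ballotPath-extend (toList v)) (𝓑⇒path v! 𝓑v))))
    (λ {v} v! 𝓑v′ → path⇒𝓑 v! (Equivalence.to (ballotPath-extend (toList v))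
      (subst (BallotPath d ∘ signature) (toList-extend v) (𝓑⇒path (extend-unique v!) 𝓑v′)))))
  (trans
    (countPerms-∑ _ left?
      (λ { {v} v! (𝓑v , ¬last) → let i , i⊤ = leftNeighbour v! 𝓑v ¬last in i , 𝓑v , ¬last , i⊤ })
      (λ { _ (𝓑v , ¬last , _) → 𝓑v , ¬last })
      (λ { v! (_ , _ , i⊤) (_ , _ , j⊤) → left-unique (toList-unique v!) i⊤ j⊤ }))
    (∑-cong λ i → countPerms-∑ (left? i) (λ j v →
        𝓑? (suc N) d v ×-dec (inject₁ i ∷ top ∷ inject₁ j ∷ [] ⊑? toList v))
      (λ { v! (𝓑v , ¬last , i⊤) → let j , i⊤j = rightNeighbour v! ¬last i⊤ in j , 𝓑v , i⊤j })
      (λ { v! (𝓑v , i⊤j) → 𝓑v , inner v! i⊤j , drop-right i⊤j })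
      (λ { v! (_ , i⊤j) (_ , i⊤k) → right-unique (toList-unique v!) i⊤j i⊤k }))))
  where
  W = Vec (Fin (suc N)) (suc N)
  top-last? : Decidable (λ (v : W) → lookup v top ≡ top)
  top-last? v = lookup v top Fin.≟ top

  left? : ∀ i → Decidable (λ (v : W) → 𝓑 (suc N) d v × lookup v top ≢ top ×
      (inject₁ i ∷ top ∷ [] ⊑ toList v))
  left? i v = 𝓑? (suc N) d v ×-dec ¬? (top-last? v) ×-dec (inject₁ i ∷ top ∷ [] ⊑? toList v)

  last-top : ∀ {v : W} r → toList v ≡ r ∷ʳ top → lookup v top ≡ top
  last-top {v} r eq with r′ , eq′ ← toList-last v = List.∷ʳ-injectiveʳ r′ r (trans (sym eq′) eq)

  leftNeighbour : ∀ {v : W} → Unique v → 𝓑 (suc N) d v → lookup v top ≢ top → ∃ λ i →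
      inject₁ i ∷ top ∷ [] ⊑ toList v
  leftNeighbour {v} v! 𝓑v ¬last with y , y↦top ← Cycles.preimage v v! top
    with r , s , eq ← ∈-∃++ (VecMembership.∈-toList⁺
        (subst (_∈ᵛ v) y↦top (VecMembership.∈-lookup y v))) = go (initLast r) s eq
    where
    go : ∀ {r} → List.InitLast r → ∀ s → toList v ≡ r ++ top ∷ s → ∃ λ i →
        inject₁ i ∷ top ∷ [] ⊑ toList v
    go []        []      eq = contradiction (last-top {v} [] eq) ¬last
    -- A word that starts with `top` and continues would fall from height 0.
    go []        (x ∷ s) eq =
        ⊥-elim (subst (λ up → StaysAbove 0 (up ∷ signature (x ∷ s))) (rise-≮ (top≮ x))
      (subst (StaysAbove 0 ∘ signature) eq (proj₁ (𝓑⇒path v! 𝓑v))))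
    go (r ∷ʳ′ x) s       eq
      with i , refl ← ≢top⇒inject₁
          (All.head (All.++⁻ʳ r (proj₁
          (unique-split (r ∷ʳ x) (subst Uniqueᴸ eq (toList-unique v!))))))
      = i , ++⇒⊑ r s (trans eq (List.++-assoc r _ _))

  rightNeighbour : ∀ {v : W} {i} → Unique v → lookup v top ≢ top → inject₁ i ∷ top ∷ [] ⊑ toList v →
    ∃ λ j → inject₁ i ∷ top ∷ inject₁ j ∷ [] ⊑ toList v
  rightNeighbour {v} {i} v! ¬last i⊤ with ⊑⇒++ i⊤
  ... | r , []    , eq = contradiction
      (last-top {v} (r ∷ʳ inject₁ i) (trans eq (sym (List.++-assoc r _ _)))) ¬last
  ... | r , x ∷ s , eq
    with j , refl ← ≢top⇒inject₁ (All.head (proj₂ (unique-split (r ∷ʳ inject₁ i)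
                      (subst Uniqueᴸ (trans eq (sym (List.++-assoc r _ _))) (toList-unique v!)))))
    = j , ++⇒⊑ r s eq

  inner : ∀ {v : W} {i j} → Unique v → inject₁ i ∷ top ∷ inject₁ j ∷ [] ⊑ toList v →
      lookup v top ≢ top
  inner {v} {i} v! i⊤j last with r , s , eq ← ⊑⇒++ i⊤j with r′ , eq′ ← toList-last v
    with () ← proj₂ (split-unique (r ∷ʳ inject₁ i) r′
      (subst Uniqueᴸ (trans eq (sym (List.++-assoc r _ _))) (toList-unique v!))
      (trans (List.++-assoc r _ _) (trans (sym eq) (trans eq′ (cong (r′ ∷ʳ_) last)))))

  drop-right : ∀ {w} {i j : Fin N} → inject₁ i ∷ top ∷ inject₁ j ∷ [] ⊑ w → inject₁ i ∷ top ∷ [] ⊑ w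
  drop-right {j = j} i⊤j with r , s , eq ← ⊑⇒++ i⊤j = ++⇒⊑ r (inject₁ j ∷ s) eq

  split-top : ∀ {w} {i j : Fin N} {s s′} r r′ → Uniqueᴸ w → w ≡ r ++ inject₁ i ∷ top ∷ s →
      w ≡ r′ ++ inject₁ j ∷ top ∷ s′ →
    i ≡ j × s ≡ s′
  split-top {i = i} {j} r r′ w! eq eq′ with r≡ , s≡ ←
      split-unique (r ∷ʳ inject₁ i) (r′ ∷ʳ inject₁ j)
    (subst Uniqueᴸ (trans eq (sym (List.++-assoc r _ _))) w!)
    (trans (List.++-assoc r _ _) (trans (sym eq) (trans eq′ (sym (List.++-assoc r′ _ _)))))
    = Fin.inject₁-injective (List.∷ʳ-injectiveʳ r r′ r≡) , s≡

  left-unique : ∀ {w} {i j : Fin N} → Uniqueᴸ w → inject₁ i ∷ top ∷ [] ⊑ w →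
      inject₁ j ∷ top ∷ [] ⊑ w → i ≡ j
  left-unique w! i⊤ j⊤ with r , _ , eq ← ⊑⇒++ i⊤ with r′ , _ , eq′ ← ⊑⇒++ j⊤ =
      proj₁ (split-top r r′ w! eq eq′)

  right-unique : ∀ {w} {i j k : Fin N} → Uniqueᴸ w → inject₁ i ∷ top ∷ inject₁ j ∷ [] ⊑ w →
    inject₁ i ∷ top ∷ inject₁ k ∷ [] ⊑ w → j ≡ k
  right-unique w! i⊤j i⊤k with r , _ , eq ← ⊑⇒++ i⊤j with r′ , _ , eq′ ← ⊑⇒++ i⊤k =
    Fin.inject₁-injective (List.∷-injectiveˡ (proj₂ (split-top r r′ w! eq eq′)))

-- Comparing the two recurrences

-- Exchanging the indices does not change a double sum, so its double is the sum of the symmetrized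
-- terms; then 2 is cancelled.
∑∑-symmetrize : ∀ {N} (F G : Fin N → Fin N → ℕ) → (∀ i j → F i j + F j i ≡ G i j + G j i) →
  ∑ {N} (λ i → ∑ {N} λ j → F i j) ≡ ∑ {N} (λ i → ∑ {N} λ j → G i j)
∑∑-symmetrize {N} F G eq = *-cancelˡ-≡ (∑∑ F) (∑∑ G) 2 (trans (double F)
  (trans (∑-cong λ i → ∑-cong λ j → eq i j) (sym (double G))))
  where
  ∑∑ : (Fin N → Fin N → ℕ) → ℕ
  ∑∑ F = ∑ λ i → ∑ λ j → F i j
  double : ∀ F → 2 * ∑∑ F ≡ ∑∑ λ i j → F i j + F j i
  double F = begin
    2 * ∑∑ F                                  ≡⟨ cong (∑∑ F +_) (+-identityʳ (∑∑ F)) ⟩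
    ∑∑ F + ∑∑ F                               ≡⟨ cong (∑∑ F +_) (∑-comm {N} {N} F) ⟩
    ∑∑ F + ∑∑ (λ i j → F j i)                 ≡⟨ ∑-distrib-+ (λ i → ∑ (F i)) (λ i → ∑ λ j → F j i) ⟨
    ∑ (λ i → ∑ (F i) + ∑ λ j → F j i)         ≡⟨ ∑-cong (λ i → ∑-distrib-+ (F i) (λ j → F j i)) ⟨
    ∑∑ (λ i j → F i j + F j i)                ∎
    where open ≡-Reasoning

-- Each diagonal reaches a pair with an entry `zero`, the letter 1. There `base` applies on either
-- side, as the claim is symmetric in i and j.
toric-agree : ∀ {M} (F G : Fin (suc M) → Fin (suc M) → ℕ) →
  (∀ a b → F (inject₁ a) (inject₁ b) ≡ F (suc a) (suc b)) →
      (∀ a b → G (inject₁ a) (inject₁ b) ≡ G (suc a) (suc b)) →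
  (∀ j → F zero j + F j zero ≡ G zero j + G j zero) → ∀ i j → F i j + F j i ≡ G i j + G j i
toric-agree {M} F G F-toric G-toric base i j = go (toℕ i) i j ≤-refl
  where
  go : ∀ k i j → toℕ i ≤ k → F i j + F j i ≡ G i j + G j i
  go _       zero    j       _        = base j
  go _       (suc a) zero    _        =
      trans (+-comm (F (suc a) zero) _) (trans (base (suc a)) (+-comm (G zero (suc a)) _))
  go (suc k) (suc a) (suc b) (s≤s le) = trans (sym (cong₂ _+_ (F-toric a b) (F-toric b a)))
    (trans (go k (inject₁ a) (inject₁ b) (subst (_≤ k) (sym (Fin.toℕ-inject₁ a)) le))
           (cong₂ _+_ (G-toric a b) (G-toric b a)))

p-through-sym : ∀ {N} d (i j : Fin N) → p-through d i j ≡ p-through d j i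
p-through-sym {suc M} d = Toric.symmetric (p-through d) (p-through-toric d) (p-through-opposite d)

NeighboursOfLargest : Set
NeighboursOfLargest = ∀ (n d j : ℕ) → n ≥ 3 → 2 ≤ j → j ≤ n ∸ 1 →
    bᶠ n d 1 j + bᶠ n d j 1 ≡ 2 * pᶜ n d 1 j

through-agree : NeighboursOfLargest → ∀ {N} d (i j : Fin N) →
  b-through d i j + b-through d j i ≡ p-through d i j + p-through d j i
through-agree hyp {suc M} d =
    toric-agree (b-through d) (p-through d) (b-through-toric d) (p-through-toric d) base
  where
  open ≡-Reasoning
  base : ∀ j → b-through d zero j + b-through d j zero ≡ p-through d zero j + p-through d j zero
  -- The hypothesis begins at j = 2. For j = 1 all four counts vanish: a letter cannot stand on both
  -- sides of n, and 1 and n would form a cycle of even length.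
  base zero = trans (cong₂ _+_ (b-through-diagonal {suc M} d zero)
      (b-through-diagonal {suc M} d zero))
                    (sym (cong₂ _+_ (p-through-diagonal {suc M} d zero)
                        (p-through-diagonal {suc M} d zero)))
  base j@(suc b) = begin
    b-through d zero j + b-through d j zero
      ≡⟨ cong₂ _+_ (bᶠ≡b-through d zero j) (bᶠ≡b-through d j zero) ⟨
    bᶠ n d 1 (suc (toℕ j)) + bᶠ n d (suc (toℕ j)) 1
      -- `b : Fin M` makes M positive, hence n = M + 2 is at least 3; the letter of `suc b` is at
      -- least 2 and at most M + 1 = n - 1.
      ≡⟨ hyp n d (suc (toℕ j)) (s≤s (s≤s (≤-trans (s≤s z≤n) (Fin.toℕ<n b)))) (s≤s (s≤s z≤n))
          (Fin.toℕ<n j) ⟩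
    2 * pᶜ n d 1 (suc (toℕ j))
      ≡⟨ cong (2 *_) (pᶜ≡p-through d zero j) ⟩
    2 * p-through d zero j
      ≡⟨ cong (p-through d zero j +_) (+-identityʳ _) ⟩
    p-through d zero j + p-through d zero j
      ≡⟨ cong (p-through d zero j +_) (p-through-sym d zero j) ⟩
    p-through d zero j + p-through d j zero ∎
    where n = suc (suc M)

b≡p : NeighboursOfLargest → ∀ n d → b n d ≡ p n d
b≡p hyp zero    zero    = refl
b≡p hyp zero    (suc d) = refl
b≡p hyp (suc N) d       = begin
  b (suc N) d
    ≡⟨ b-suc N d ⟩
  b N d + ∑ {N} (λ i → ∑ {N} λ j → b-through d i j)
    ≡⟨ cong₂ _+_ (b≡p hyp N d)
        (∑∑-symmetrize {N} (b-through d) (p-through d) (through-agree hyp d)) ⟩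
  p N d + ∑ {N} (λ i → ∑ {N} λ j → p-through d i j)
    ≡⟨ cong (p N d +_) (∑-comm {N} {N} (p-through d)) ⟩
  p N d + ∑ {N} (λ j → ∑ {N} λ i → p-through d i j)
    ≡⟨ p-suc N d ⟨
  p (suc N) d ∎
  where open ≡-Reasoning

theorem3p4 : (∀ (n d j : ℕ) → n ≥ 3 → 2 ≤ j → j ≤ n ∸ 1 →
    bᶠ n d 1 j + bᶠ n d j 1 ≡ 2 * pᶜ n d 1 j) →
    ∀ (n d : ℕ) → n ≥ 1 → d ≤ ⌊ n ∸ 1 /2⌋ → b n d ≡ p n d
theorem3p4 hyp n d _ _ = b≡p hyp n d
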